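{- There is a constant $c>0$ such that for any $i,j,\ell \in \mathbb{N}$ with $\ell \leq ij - i -j$ and $\frac{1}{2}\leq \frac{i}{j}\leq 2$, \[ C(i,j,\ell)\leq i^{j}j^{i}(i+j)^{\frac{3\ell-1}{2}}\left(\frac{c}{\ell}\right)^{\frac{\ell}{2}}. \]
   Context: $\mathbb{N}$ is the set of positive integers. For $i,j\in\mathbb{N}$ and $\ell\in\mathbb{Z}$, $C(i,j,\ell)$ denotes the number of connected bipartite graphs on labelled vertices with $i$ vertices in one (given) partition class, $j$ vertices in the second (given) partition class, and $i+j+\ell$ edges. -}

module Defs where

open import Algebra.Definitions.RawSemiring using () renaming (_^_ to pow)
open import Data.Fin.Base using (Fin; combine)
open import Data.Fin.Subset using (Subset; Side; inside; outside; _∈_; ∣_∣)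
open import Data.Fin.Subset.Properties using (_∈?_)
import Data.Fin.Properties as Fin
open import Data.Integer.Base as ℤ using (ℤ; +_)
import Data.Integer.Properties as ℤ
open import Data.List.Base using (List; []; _∷_; _++_; map; filter; length; allFin)
open import Data.List.Membership.Propositional using () renaming (_∈_ to _∈ˡ_)
open import Data.List.Membership.Propositional.Properties
  using (∈-allFin; ∈-map⁺; ∈-++⁺ˡ; ∈-++⁺ʳ)
open import Data.List.Relation.Unary.All as All using ()
open import Data.List.Relation.Unary.Any using (here; there)
open import Data.Nat.Base as ℕ using (ℕ; zero; suc)
open import Data.Product.Base using (∃₂; _×_; _,_)
open import Data.Rational.Base as ℚ using (ℚ; 0ℚ)
open import Data.Sum.Base using (_⊎_; inj₁; inj₂)
import Data.Sum.Properties as Sum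
open import Data.Vec.Base using ([]; _∷_)
open import Level using (0ℓ)
open import Relation.Binary.Construct.Closure.ReflexiveTransitive
  using (Star; ε; _◅_; _◅◅_)
open import Relation.Binary.PropositionalEquality using (_≡_; refl)
open import Relation.Nullary.Decidable using (Dec; yes; no; map′; _×-dec_; _⊎-dec_)
open import Relation.Unary using (Pred; Decidable; _⊆_)

-- The potential edges x — y (x : Fin i, y : Fin j) are numbered by
-- `combine x y`, a bijection Fin i × Fin j → Fin (i * j).

BipartiteGraph : ℕ → ℕ → Set
BipartiteGraph i j = Subset (i ℕ.* j)

Vertex : ℕ → ℕ → Set
Vertex i j = Fin i ⊎ Fin j

module _ (i j : ℕ) (G : BipartiteGraph i j) where

  data Adjacent : Vertex i j → Vertex i j → Set where
    l—r : ∀ {x y} → combine x y ∈ G → Adjacent (inj₁ x) (inj₂ y)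
    r—l : ∀ {x y} → combine x y ∈ G → Adjacent (inj₂ y) (inj₁ x)

  Connected : Set
  Connected = ∀ u v → Star Adjacent u v

  adjacent? : ∀ u v → Dec (Adjacent u v)
  adjacent? (inj₁ x) (inj₂ y) = map′ l—r (λ { (l—r e) → e }) (combine x y ∈? G)
  adjacent? (inj₂ y) (inj₁ x) = map′ r—l (λ { (r—l e) → e }) (combine x y ∈? G)
  adjacent? (inj₁ _) (inj₁ _) = no λ ()
  adjacent? (inj₂ _) (inj₂ _) = no λ ()

  -- Warshall's algorithm: Via vs u v says that u and v are joined by a
  -- walk whose interior vertices lie in vs.

  Via : List (Vertex i j) → Vertex i j → Vertex i j → Set
  Via []       u v = u ≡ v ⊎ Adjacent u v
  Via (w ∷ vs) u v = Via vs u v ⊎ (Via vs u w × Via vs w v)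

  via? : ∀ vs u v → Dec (Via vs u v)
  via? []       u v = Sum.≡-dec Fin._≟_ Fin._≟_ u v ⊎-dec adjacent? u v
  via? (w ∷ vs) u v = via? vs u v ⊎-dec (via? vs u w ×-dec via? vs w v)

  via⇒star : ∀ vs {u v} → Via vs u v → Star Adjacent u v
  via⇒star []       (inj₁ refl)    = ε
  via⇒star []       (inj₂ a)       = a ◅ ε
  via⇒star (w ∷ vs) (inj₁ p)       = via⇒star vs p
  via⇒star (w ∷ vs) (inj₂ (p , q)) = via⇒star vs p ◅◅ via⇒star vs q

  via-base : ∀ vs {u v} → Via [] u v → Via vs u v
  via-base []       p = p
  via-base (w ∷ vs) p = inj₁ (via-base vs p)

  via-trans : ∀ vs {u w v} → w ∈ˡ vs → Via vs u w → Via vs w v → Via vs u v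
  via-trans (x ∷ vs) {u} {_} {v} (here refl) p q = inj₂ (to p , from q)
    where
    to : Via (x ∷ vs) u x → Via vs u x
    to (inj₁ r)       = r
    to (inj₂ (r , _)) = r
    from : Via (x ∷ vs) x v → Via vs x v
    from (inj₁ r)       = r
    from (inj₂ (_ , r)) = r
  via-trans (x ∷ vs) (there m) (inj₁ p) (inj₁ q) = inj₁ (via-trans vs m p q)
  via-trans (x ∷ vs) (there m) (inj₁ p) (inj₂ (q , r)) =
    inj₂ (via-trans vs m p q , r)
  via-trans (x ∷ vs) (there m) (inj₂ (p , q)) (inj₁ r) =
    inj₂ (p , via-trans vs m q r)
  via-trans (x ∷ vs) (there m) (inj₂ (p , _)) (inj₂ (_ , r)) = inj₂ (p , r)

  vertices : List (Vertex i j)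
  vertices = map inj₁ (allFin i) ++ map inj₂ (allFin j)

  ∈-vertices : ∀ v → v ∈ˡ vertices
  ∈-vertices (inj₁ x) = ∈-++⁺ˡ (∈-map⁺ inj₁ (∈-allFin x))
  ∈-vertices (inj₂ y) = ∈-++⁺ʳ (map inj₁ (allFin i)) (∈-map⁺ inj₂ (∈-allFin y))

  star⇒via : ∀ {u v} → Star Adjacent u v → Via vertices u v
  star⇒via ε        = via-base vertices (inj₁ refl)
  star⇒via (_◅_ {j = w} a s) =
    via-trans vertices (∈-vertices w) (via-base vertices (inj₂ a)) (star⇒via s)

  star? : ∀ u v → Dec (Star Adjacent u v)
  star? u v = map′ (via⇒star vertices) star⇒via (via? vertices u v)

  connected? : Dec Connected
  connected? = map′
    (λ h u v → All.lookup (All.lookup h (∈-vertices u)) (∈-vertices v))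
    (λ h → All.tabulate λ {u} _ → All.tabulate λ {v} _ → h u v)
    (All.all? (λ u → All.all? (star? u) vertices) vertices)

-- Every subset of Fin n, each exactly once.
subsets : ∀ n → List (Subset n)
subsets zero    = [] ∷ []
subsets (suc n) = map (outside ∷_) (subsets n) ++ map (inside ∷_) (subsets n)

Counted : ∀ i j → ℤ → Pred (BipartiteGraph i j) 0ℓ
Counted i j ℓ G = Connected i j G × + ∣ G ∣ ≡ + i ℤ.+ + j ℤ.+ ℓ

counted? : ∀ i j ℓ → Decidable (Counted i j ℓ)
counted? i j ℓ G = connected? i j G ×-dec (+ ∣ G ∣ ℤ.≟ + i ℤ.+ + j ℤ.+ ℓ)

C : ℕ → ℕ → ℤ → ℕ
C i j ℓ = length (filter (counted? i j ℓ) (subsets (i ℕ.* j)))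

-- A nonnegative real r is represented by its open upper Dedekind cut, the
-- set of all rationals q with r < q.  Only the operations below are used
-- to build cuts.

Real≥0 : Set₁
Real≥0 = Pred ℚ 0ℓ

infix  4 _≤ᴿ_
infixl 7 _·_
infixr 8 _^ℚ_ _^_/2

-- A larger real has fewer rationals above it.
_≤ᴿ_ : Real≥0 → Real≥0 → Set
r ≤ᴿ s = s ⊆ r

fromℕ : ℕ → Real≥0
fromℕ n q = + n ℚ./ 1 ℚ.< q

-- Since all elements of the two cuts are positive, the infimum of the
-- products a * b is the product of the two infima.
_·_ : Real≥0 → Real≥0 → Real≥0
(r · s) q = ∃₂ λ a b → r a × s b × a ℚ.* b ℚ.≤ q

_^ℚ_ : ℚ → ℕ → ℚ
_^ℚ_ = pow ℚ.+-*-rawSemiring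

-- For x ≥ 0, the real x^(n/2), that is, the square root of x^n: a rational
-- q is above it iff q > 0 and q² > x^n.
_^_/2 : ℚ → ℕ → Real≥0
(x ^ n /2) q = 0ℚ ℚ.< q × x ^ℚ n ℚ.< q ℚ.* q

-- Let n = i + j and k = ℓ + 1. Rooting G at one of the i left vertices, depth-first search gives
-- a spanning tree T such that the k remaining edges of G all join a vertex to one of its
-- ancestors. Hence i · C(i,j,ℓ) · k! ≤ ∑_T (∑_v depth_T(v))^k ≤ n^ℓ ∑_v ∑_T depth_T(v)^k by the
-- power mean inequality. Given v, a tree is a path from v to the root together with a forest
-- rooted on that path. By Cayley's formula for the forests, the number of pairs (T , v) with v
-- on the right whose path has s vertices on each side is W(s) − W(s+1) for
-- W(s) = (i)_s (j)_s i^(j−s) j^(i−s), with falling factorials (i)_s and (j)_s, and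
-- s · W(s) ≤ i · (W(s) − W(s+1)); left vertices v are similar. Summation by parts then bounds
-- the (m+2)-nd moment of s by (m+2) · i times the m-th one, so that the 2k-th moment is at most
-- k! (2i)^k i^j j^i, and Cauchy–Schwarz returns to the k-th moment.

module Submission where

open import Defs
open import Data.Nat.Base as ℕ using (ℕ; NonZero)
open import Data.Integer.Base as ℤ using (+_)
open import Data.Product.Base using (∃-syntax; _×_)
open import Data.Rational.Base as ℚ using (ℚ; 0ℚ; ½)

open import Algebra.Bundles using (module CommutativeMonoid)
import Algebra.Properties.CommutativeSemigroup as CommutativeSemigroup
open import Data.Empty using (⊥; ⊥-elim)
open import Data.Fin.Base using (Fin; zero; suc; combine)
import Data.Fin.Properties as Fin
open import Data.Fin.Subset using (Subset; inside; outside; ∣_∣) renaming (_∈_ to _∈ˢ_)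
open import Data.Fin.Subset.Properties using (⊆-antisym)
import Data.Integer.Properties as ℤ
open import Data.List.Base
  using (List; []; _∷_; _++_; map; length; concatMap; filter; allFin; cartesianProduct; drop; take)
open import Data.List.Membership.Propositional using (_∈_; find; lose)
open import Data.List.Membership.Propositional.Properties
open import Data.List.Properties as List
  using (length-++; length-map; length-tabulate; length-drop; filter-accept; ∷-injective)
import Data.List.Relation.Binary.Sublist.Propositional as Sublist
import Data.List.Relation.Binary.Sublist.Propositional.Properties as Sublist
open import Data.List.Relation.Unary.All as All using (All; []; _∷_)
import Data.List.Relation.Unary.All.Properties as All
open import Data.List.Relation.Unary.AllPairs as AllPairs using (AllPairs; []; _∷_)
open import Data.List.Relation.Unary.Any as Any using (Any; here; there)
open import Data.List.Relation.Unary.Unique.Propositional using (Unique)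
import Data.List.Relation.Unary.Unique.Propositional.Properties as Unique
open import Data.Nat.Base
  using (zero; suc; pred; _+_; _*_; _^_; _∸_; _≤_; _<_; z≤n; s≤s⁻¹; _!)
open import Data.Nat.Properties as ℕ
open import Data.Nat.Tactic.RingSolver using (solve-∀)
open import Data.Product.Base using (_,_; proj₁; proj₂; uncurry)
open import Data.Rational.Base using (1ℚ; fromℚᵘ; positive; nonNegative)
import Data.Rational.Properties as ℚ
open import Data.Rational.Unnormalised.Base as ℚᵘ using (mkℚᵘ; *≤*; *≡*)
import Data.Rational.Unnormalised.Properties as ℚᵘ
open import Data.Sum.Base as Sum using (_⊎_; inj₁; inj₂; [_,_]′)
import Data.Sum.Properties as Sum
open import Data.Vec.Base as Vec using ([]; _∷_)
open import Function.Base using (_∘_)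
open import Relation.Binary.Construct.Closure.ReflexiveTransitive using (Star; ε; _◅_)
open import Relation.Binary.PropositionalEquality
open import Relation.Nullary using (¬_; Dec; yes; no; contradiction)
open import Relation.Nullary.Decidable using (_×-dec_; ¬?; map′; decidable-stable)

-- Sums over lists

-- The decay (c/ℓ)^(ℓ/2) appears only after squaring: (k! · C)² carries two factors k!, the squared
-- moment bound uses up one of them, and the other is at least (ℓ/4)^ℓ. The exponent (3ℓ-1)/2 arises
-- in the same way: up to constants i² · k! · C² is at most n^(2ℓ) · n^k · (i^j j^i)², and i ≥ n/3
-- removes n². Since upper bounds suffice, no bijection is built. Trees contain functions and are
-- known only up to agreement of their ancestor lists, so all counting goes through relations under
-- which one code can belong to at most one object; codes that belong to no object do no harm.
-- Likewise only the upper half of Cayley's formula is proved, by exploring a forest root by root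
-- and applying the binomial theorem to the choice of children.

∑ : {A : Set} → List A → (A → ℕ) → ℕ
∑ []       f = 0
∑ (x ∷ xs) f = f x + ∑ xs f

module _ {A : Set} where

  ∑-cong : ∀ (xs : List A) {f g : A → ℕ} → (∀ x → f x ≡ g x) → ∑ xs f ≡ ∑ xs g
  ∑-cong []       h = refl
  ∑-cong (x ∷ xs) h = cong₂ _+_ (h x) (∑-cong xs h)

  ∑-mono : ∀ {xs : List A} {f g : A → ℕ} → All (λ x → f x ≤ g x) xs → ∑ xs f ≤ ∑ xs g
  ∑-mono []       = z≤n
  ∑-mono (p ∷ ps) = +-mono-≤ p (∑-mono ps)

  ∑-mono′ : ∀ (xs : List A) {f g : A → ℕ} → (∀ x → f x ≤ g x) → ∑ xs f ≤ ∑ xs g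
  ∑-mono′ xs h = ∑-mono (All.tabulate {xs = xs} λ {x} _ → h x)

  ∑-++ : ∀ (xs ys : List A) f → ∑ (xs ++ ys) f ≡ ∑ xs f + ∑ ys f
  ∑-++ []       ys f = refl
  ∑-++ (x ∷ xs) ys f = trans (cong (f x ℕ.+_) (∑-++ xs ys f)) (sym (+-assoc (f x) _ _))

  ∑-map : ∀ {B : Set} (h : B → A) xs f → ∑ (map h xs) f ≡ ∑ xs (λ x → f (h x))
  ∑-map h []       f = refl
  ∑-map h (x ∷ xs) f = cong (f (h x) ℕ.+_) (∑-map h xs f)

  ∑-concatMap : ∀ {B : Set} (h : B → List A) xs f →
                ∑ (concatMap h xs) f ≡ ∑ xs (λ x → ∑ (h x) f)
  ∑-concatMap h []       f = refl
  ∑-concatMap h (x ∷ xs) f =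
    trans (∑-++ (h x) _ f) (cong (∑ (h x) f ℕ.+_) (∑-concatMap h xs f))

  ∑-const : ∀ (xs : List A) c → ∑ xs (λ _ → c) ≡ length xs * c
  ∑-const []       c = refl
  ∑-const (x ∷ xs) c = cong (c ℕ.+_) (∑-const xs c)

  length-as-∑ : ∀ (xs : List A) → length xs ≡ ∑ xs (λ _ → 1)
  length-as-∑ xs = sym (trans (∑-const xs 1) (*-identityʳ _))

  ∑-+ : ∀ (xs : List A) f g → ∑ xs (λ x → f x + g x) ≡ ∑ xs f + ∑ xs g
  ∑-+ []       f g = refl
  ∑-+ (x ∷ xs) f g rewrite ∑-+ xs f g = lemma (f x) (g x) (∑ xs f) (∑ xs g)
    where
    lemma : ∀ a b c d → a + b + (c + d) ≡ a + c + (b + d)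
    lemma = solve-∀

  ∑-*ˡ : ∀ c (xs : List A) f → ∑ xs (λ x → c * f x) ≡ c * ∑ xs f
  ∑-*ˡ c []       f = sym (*-zeroʳ c)
  ∑-*ˡ c (x ∷ xs) f rewrite ∑-*ˡ c xs f = sym (*-distribˡ-+ c (f x) _)

∑-swap : ∀ {A B : Set} (xs : List A) (ys : List B) (f : A → B → ℕ) →
         ∑ xs (λ x → ∑ ys (f x)) ≡ ∑ ys (λ y → ∑ xs (λ x → f x y))
∑-swap []       ys f = sym (trans (∑-const ys 0) (*-zeroʳ (length ys)))
∑-swap (x ∷ xs) ys f =
  trans (cong (∑ ys (f x) ℕ.+_) (∑-swap xs ys f))
        (sym (∑-+ ys (f x) (λ y → ∑ xs (λ z → f z y))))

module _ {A B : Set} (R : A → B → Set) {f : A → ℕ} {g : B → ℕ} where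

  private
    Hit : A → List B → Set
    Hit a zs = Any (λ b → R a b × f a ≤ g b) zs

    Separated : A → A → Set
    Separated a a′ = ∀ b → R a b → R a′ b → ⊥

    hit-─ : ∀ {a a′ zs} (h : Hit a zs) → Separated a a′ → Hit a′ zs → Hit a′ (zs Any.─ h)
    hit-─ (here (r , _)) sep (here (r′ , _)) = ⊥-elim (sep _ r r′)
    hit-─ (here _)       sep (there h′)      = h′
    hit-─ (there h)      sep (here p)        = here p
    hit-─ (there h)      sep (there h′)      = there (hit-─ h sep h′)

    ∑-─ : ∀ {a zs} (h : Hit a zs) → f a + ∑ (zs Any.─ h) g ≤ ∑ zs g
    ∑-─ (here (_ , le))  = +-monoˡ-≤ _ le
    ∑-─ {a} {z ∷ zs} (there h) = begin
      f a + (g z + ∑ (zs Any.─ h) g)  ≡⟨ swap (f a) (g z) _ ⟩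
      g z + (f a + ∑ (zs Any.─ h) g)  ≤⟨ +-monoʳ-≤ (g z) (∑-─ h) ⟩
      g z + ∑ zs g                    ∎
      where
      open ≤-Reasoning
      swap : ∀ a b c → a + (b + c) ≡ b + (a + c)
      swap = solve-∀

  -- Deleting from `zs` the entry that `x` hits does not disturb the rest of `xs`, because separated
  -- elements cannot hit the same entry. Nothing is asked of `zs`: it may repeat entries or contain
  -- unrelated ones.
  ∑-injection : ∀ {xs zs} → AllPairs Separated xs → All (λ x → Hit x zs) xs → ∑ xs f ≤ ∑ zs g
  ∑-injection []           []       = z≤n
  ∑-injection (seps ∷ sep) (h ∷ hs) = ≤-trans
    (+-monoʳ-≤ _ (∑-injection sep
      (All.map (λ (s , h′) → hit-─ h s h′) (All.zip (seps , hs)))))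
    (∑-─ h)

-- Greedy choice: an entry is kept unless it is related to one already kept. It stands in for
-- removing duplicates where equality is undecidable, as it is for trees given by functions.
representatives : ∀ {A : Set} {_≈_ : A → A → Set} → (∀ x y → Dec (x ≈ y)) →
  (∀ {x} → x ≈ x) → ∀ xs →
  ∃[ ys ] AllPairs (λ x y → ¬ x ≈ y) ys × All (λ x → Any (x ≈_) ys) xs
representatives _≈?_ ≈-refl [] = [] , [] , []
representatives _≈?_ ≈-refl (x ∷ xs) with representatives _≈?_ ≈-refl xs
... | ys , sep , cover with Any.any? (x ≈?_) ys
...   | yes x∈ys = ys , sep , x∈ys ∷ cover
...   | no  x∉ys = x ∷ ys , All.¬Any⇒All¬ ys x∉ys ∷ sep ,
                   here ≈-refl ∷ All.map there cover

-- Power means by Chebyshev's sum inequality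

2xy≤x²+y² : ∀ x y → 2 * (x * y) ≤ x * x + y * y
2xy≤x²+y² x y = [ ordered x y , (λ y≤x → subst₂ _≤_ (cong (2 *_) (*-comm y x))
    (+-comm (y * y) (x * x)) (ordered y x y≤x)) ]′ (≤-total x y)
  where
  ordered : ∀ x y → x ≤ y → 2 * (x * y) ≤ x * x + y * y
  ordered x y x≤y with d , refl ← m≤n⇒∃[o]m+o≡n x≤y =
    subst (2 * (x * (x + d)) ≤_) (square x d) (m≤m+n _ (d * d))
    where
    square : ∀ x d → 2 * (x * (x + d)) + d * d ≡ x * x + (x + d) * (x + d)
    square = solve-∀

-- The difference of the two sides is (x - y)(x^k - y^k), and both factors have the same sign; in
-- `ordered` this product is `d * e`.
rearrangement : ∀ x y k → x * y ^ k + y * x ^ k ≤ x * x ^ k + y * y ^ k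
rearrangement x y k = [ ordered x y , (λ y≤x →
    subst₂ _≤_ (+-comm (y * x ^ k) _) (+-comm (y * y ^ k) _) (ordered y x y≤x)) ]′ (≤-total x y)
  where
  ordered : ∀ x y → x ≤ y → x * y ^ k + y * x ^ k ≤ x * x ^ k + y * y ^ k
  ordered x y x≤y with d , refl ← m≤n⇒∃[o]m+o≡n x≤y
                  with e , eq ← m≤n⇒∃[o]m+o≡n (^-monoˡ-≤ k x≤y) rewrite sym eq =
    subst (x * (x ^ k + e) + (x + d) * x ^ k ≤_) (expand x d (x ^ k) e) (m≤m+n _ (d * e))
    where
    expand : ∀ x d p e → x * (p + e) + (x + d) * p + d * e ≡ x * p + (x + d) * (p + e)
    expand = solve-∀

module _ {A : Set} (f : A → ℕ) where

  -- Chebyshev's sum inequality for the similarly ordered sequences f and f^k. The products of the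
  -- new entry with the old ones are compared pair by pair, so the list need not be sorted.
  chebyshev : ∀ k (xs : List A) → ∑ xs f * ∑ xs (λ x → f x ^ k) ≤ length xs * ∑ xs (λ x →
      f x * f x ^ k)
  chebyshev k []       = z≤n
  chebyshev k (x ∷ xs) = begin
    (a + s) * (p + t)                                ≡⟨ expand a s p t ⟩
    a * p + (a * t + p * s) + s * t
        ≤⟨ +-mono-≤ (+-monoʳ-≤ (a * p) cross) (chebyshev k xs) ⟩
    a * p + (length xs * (a * p) + u) + length xs * u ≡⟨ collect (a * p) (length xs) u ⟩
    suc (length xs) * (a * p + u)                    ∎
    where
    open ≤-Reasoning
    a = f x
    p = f x ^ k
    s = ∑ xs f
    t = ∑ xs (λ y → f y ^ k)
    u = ∑ xs (λ y → f y * f y ^ k)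
    expand : ∀ a s p t → (a + s) * (p + t) ≡ a * p + (a * t + p * s) + s * t
    expand = solve-∀
    collect : ∀ z l u → z + (l * z + u) + l * u ≡ suc l * (z + u)
    collect = solve-∀
    cross : a * t + p * s ≤ length xs * (a * p) + u
    cross = begin
      a * t + p * s
        ≡⟨ cong₂ _+_ (sym (∑-*ˡ a xs _)) (sym (∑-*ˡ p xs _)) ⟩
      ∑ xs (λ y → a * f y ^ k) + ∑ xs (λ y → p * f y)
        ≡⟨ sym (∑-+ xs _ _) ⟩
      ∑ xs (λ y → a * f y ^ k + p * f y)
        ≤⟨ ∑-mono′ xs (λ y → subst (λ z → a * f y ^ k + z ≤ a * p + f y * f y ^ k)
            (*-comm (f y) p) (rearrangement a (f y) k)) ⟩
      ∑ xs (λ y → a * p + f y * f y ^ k)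
        ≡⟨ ∑-+ xs _ _ ⟩
      ∑ xs (λ _ → a * p) + u
        ≡⟨ cong (_+ u) (∑-const xs (a * p)) ⟩
      length xs * (a * p) + u ∎

  powerMean : ∀ k (xs : List A) → ∑ xs f ^ suc k ≤ length xs ^ k * ∑ xs (λ x → f x ^ suc k)
  powerMean zero    xs = ≤-reflexive (begin
    ∑ xs f * 1                 ≡⟨ *-identityʳ _ ⟩
    ∑ xs f                     ≡⟨ ∑-cong xs (λ x → sym (*-identityʳ (f x))) ⟩
    ∑ xs (λ x → f x * 1)       ≡⟨ *-identityˡ _ ⟨
    1 * ∑ xs (λ x → f x * 1)   ∎)
    where open ≡-Reasoning
  powerMean (suc k) xs = begin
    ∑ xs f * ∑ xs f ^ suc k
      ≤⟨ *-monoʳ-≤ (∑ xs f) (powerMean k xs) ⟩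
    ∑ xs f * (length xs ^ k * ∑ xs (λ x → f x ^ suc k))
      ≡⟨ *-left-comm (∑ xs f) (length xs ^ k) _ ⟩
    length xs ^ k * (∑ xs f * ∑ xs (λ x → f x ^ suc k))
      ≤⟨ *-monoʳ-≤ (length xs ^ k) (chebyshev (suc k) xs) ⟩
    length xs ^ k * (length xs * ∑ xs (λ x → f x ^ suc (suc k)))
      ≡⟨ trans (*-left-comm (length xs ^ k) (length xs) _) (sym (*-assoc (length xs) _ _)) ⟩
    length xs * length xs ^ k * ∑ xs (λ x → f x ^ suc (suc k)) ∎
    where
    open ≤-Reasoning
    *-left-comm : ∀ a b c → a * (b * c) ≡ b * (a * c)
    *-left-comm = solve-∀

-- Sublists of a given length

sublists : ∀ {A : Set} → ℕ → List A → List (List A)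
sublists zero    xs       = [] ∷ []
sublists (suc k) []       = []
sublists (suc k) (x ∷ xs) = map (x ∷_) (sublists k xs) ++ sublists (suc k) xs

sublists-complete : ∀ {A : Set} {xs ys : List A} → xs Sublist.⊆ ys → xs ∈ sublists (length xs) ys
sublists-complete Sublist.[] = here refl
sublists-complete {xs = []} (_ Sublist.∷ʳ _) = here refl
sublists-complete {xs = x ∷ xs} (y Sublist.∷ʳ p) = ∈-++⁺ʳ (map (y ∷_) _) (sublists-complete p)
sublists-complete (refl Sublist.∷ p) = ∈-++⁺ˡ (∈-map⁺ (_ ∷_) (sublists-complete p))

-- The left side consists of the two leading terms of the binomial expansion of the right side.
bernoulli : ∀ m k → m ^ suc k + suc k * m ^ k ≤ suc m ^ suc k
bernoulli m zero    = ≤-reflexive (eq m)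
  where
  eq : ∀ m → m * 1 + 1 * 1 ≡ suc m * 1
  eq = solve-∀
bernoulli m (suc k) = begin
  m * (m * p) + suc (suc k) * (m * p)        ≤⟨ m≤m+n _ (suc k * p) ⟩
  m * (m * p) + suc (suc k) * (m * p) + suc k * p ≡⟨ eq m p (suc k) ⟩
  suc m * (m * p + suc k * p)                ≤⟨ *-monoʳ-≤ (suc m) (bernoulli m k) ⟩
  suc m * suc m ^ suc k                      ∎
  where
  open ≤-Reasoning
  p = m ^ k
  eq : ∀ m p k → m * (m * p) + suc k * (m * p) + k * p ≡ suc m * (m * p + k * p)
  eq = solve-∀

-- Pascal's rule reduces the step to `bernoulli`. The factor `k !` is the source of the decay in ℓ
-- of the final bound.
length-sublists : ∀ {A : Set} k (xs : List A) → k ! * length (sublists k xs) ≤ length xs ^ k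
length-sublists zero    xs       = ≤-refl
length-sublists (suc k) []       = ≤-reflexive (*-zeroʳ (suc k !))
length-sublists (suc k) (x ∷ xs) = begin
  suc k ! * length (map (x ∷_) (sublists k xs) ++ sublists (suc k) xs)
    ≡⟨ cong (suc k ! *_) (trans (length-++ (map (x ∷_) (sublists k xs)))
                                (cong (_+ _) (length-map (x ∷_) (sublists k xs)))) ⟩
  suc k ! * (length (sublists k xs) + length (sublists (suc k) xs))
    ≡⟨ eq (suc k) (k !) (length (sublists k xs)) _ ⟩
  suc k ! * length (sublists (suc k) xs) + suc k * (k ! * length (sublists k xs))
    ≤⟨ +-mono-≤ (length-sublists (suc k) xs) (*-monoʳ-≤ (suc k) (length-sublists k xs)) ⟩
  length xs ^ suc k + suc k * length xs ^ k
    ≤⟨ bernoulli (length xs) k ⟩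
  suc (length xs) ^ suc k ∎
  where
  open ≤-Reasoning
  eq : ∀ k f a b → k * f * (a + b) ≡ k * f * b + k * (f * a)
  eq = solve-∀

^-distribʳ-* : ∀ k m n → (m * n) ^ k ≡ m ^ k * n ^ k
^-distribʳ-* zero    m n = refl
^-distribʳ-* (suc k) m n = trans (cong (m * n *_) (^-distribʳ-* k m n)) (eq m n (m ^ k) (n ^ k))
  where
  eq : ∀ a b c d → a * b * (c * d) ≡ a * c * (b * d)
  eq = solve-∀

-- Moments of the path length

-- The derivative of N ^ q with respect to N.
dpow : ℕ → ℕ → ℕ
dpow N zero    = 0
dpow N (suc q) = N ^ q + N * dpow N q

dpow-suc : ∀ N q → dpow N (suc q) ≡ suc q * N ^ q
dpow-suc N zero    = cong suc (*-zeroʳ N)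
dpow-suc N (suc q) = trans (cong (λ d → N ^ suc q + N * d) (dpow-suc N q)) (eq N (N ^ q) q)
  where
  eq : ∀ N p q → N * p + N * (suc q * p) ≡ suc (suc q) * (N * p)
  eq = solve-∀

*-dpow : ∀ N q → N * dpow N q ≡ q * N ^ q
*-dpow N zero    = *-zeroʳ N
*-dpow N (suc q) = trans (cong (N *_) (dpow-suc N q)) (eq N q (N ^ q))
  where
  eq : ∀ N q p → N * (suc q * p) ≡ suc q * (N * p)
  eq = solve-∀

-- In K_{i,j} with p left and q right vertices outside a set of roots, functions p q
-- counts the choices of a neighbour for each of these vertices, and forests p q
-- (Cayley's formula) the acyclic choices.
module _ (i j : ℕ) where

  functions : ℕ → ℕ → ℕ
  functions p q = j ^ p * i ^ q

  forests : ℕ → ℕ → ℕ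
  forests p q = functions p q ∸ dpow j p * dpow i q

  -- The paths from a fixed vertex that are continued from a path leaving p
  -- and q vertices uncovered, weighted by the number of forests rooted on
  -- them and by g of half their length, which is s at the start.
  pathSum : (ℕ → ℕ) → ℕ → ℕ → ℕ → ℕ
  pathSum g zero    q       s = forests 0 q * g s
  pathSum g (suc p) zero    s = forests (suc p) 0 * g s
  pathSum g (suc p) (suc q) s =
    forests (suc p) (suc q) * g s + suc p * suc q * pathSum g p q (suc s)

  module _ .{{_ : NonZero i}} where

    -- Because q ≤ j, the product subtracted in `forests p q` is, after multiplication by `i`, at
    -- most `p * functions p q`. Hence `i * forests p q` is at least (i - p) times `functions p q`,
    -- and s ≤ i - p. In probabilistic terms, a path with s vertices on each side ends there with
    -- probability at least s/i.
    functions-forests : ∀ {p q s} → p + s ≤ i → q ≤ j → s * functions p q ≤ i * forests p q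
    functions-forests {p} {q} {s} p+s≤i q≤j = +-cancelʳ-≤ (p * functions p q) _ _ (begin
      s * functions p q + p * functions p q       ≡⟨ *-distribʳ-+ (functions p q) s p ⟨
      (s + p) * functions p q
          ≤⟨ *-monoˡ-≤ (functions p q) (≤-trans (≤-reflexive (+-comm s p)) p+s≤i) ⟩
      i * functions p q                           ≤⟨ *-monoʳ-≤ i (m≤n+m∸n (functions p q) dd) ⟩
      i * (dd + forests p q)                      ≡⟨ *-distribˡ-+ i dd _ ⟩
      i * dd + i * forests p q                    ≤⟨ +-monoˡ-≤ (i * forests p q) (dd-bound p) ⟩
      p * functions p q + i * forests p q         ≡⟨ +-comm (p * functions p q) _ ⟩
      i * forests p q + p * functions p q         ∎)
      where
      open ≤-Reasoning
      dd = dpow j p * dpow i q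
      dd-bound : ∀ p → i * (dpow j p * dpow i q) ≤ p * functions p q
      dd-bound zero    = ≤-reflexive (*-zeroʳ i)
      dd-bound (suc p) = begin
        i * (dpow j (suc p) * dpow i q)        ≡⟨ cong (λ d → i * (d * dpow i q)) (dpow-suc j p) ⟩
        i * (suc p * j ^ p * dpow i q)         ≡⟨ eq₁ i (suc p * j ^ p) _ ⟩
        suc p * j ^ p * (i * dpow i q)         ≡⟨ cong (suc p * j ^ p *_) (*-dpow i q) ⟩
        suc p * j ^ p * (q * i ^ q)
            ≤⟨ *-monoʳ-≤ (suc p * j ^ p) (*-monoˡ-≤ (i ^ q) q≤j) ⟩
        suc p * j ^ p * (j * i ^ q)            ≡⟨ eq₂ (suc p) (j ^ p) j (i ^ q) ⟩
        suc p * (j * j ^ p * i ^ q)            ∎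
        where
        eq₁ : ∀ a b c → a * (b * c) ≡ b * (a * c)
        eq₁ = solve-∀
        eq₂ : ∀ a b c d → a * b * (c * d) ≡ a * (c * b * d)
        eq₂ = solve-∀

    -- The product subtracted in `forests (suc p) (suc q)` equals `suc p * suc q * functions p q`;
    -- the bounds on p and q ensure that the truncated subtraction is a true one.
    forests-step : ∀ {p q} → suc p ≤ i → suc q ≤ j →
      forests (suc p) (suc q) + suc p * suc q * functions p q ≤ functions (suc p) (suc q)
    forests-step {p} {q} p<i q<j = begin
      forests (suc p) (suc q) + suc p * suc q * functions p q
        ≡⟨ cong (forests (suc p) (suc q) ℕ.+_) (trans (eq (suc p) (suc q) (j ^ p) (i ^ q))
             (sym (cong₂ _*_ (dpow-suc j p) (dpow-suc i q)))) ⟩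
      functions (suc p) (suc q) ∸ dd + dd
        ≡⟨ m∸n+n≡m dd≤ ⟩
      functions (suc p) (suc q) ∎
      where
      open ≤-Reasoning
      dd = dpow j (suc p) * dpow i (suc q)
      eq : ∀ a b c d → a * b * (c * d) ≡ a * c * (b * d)
      eq = solve-∀
      dd≤ : dd ≤ functions (suc p) (suc q)
      dd≤ = begin
        dd                                  ≡⟨ cong₂ _*_ (dpow-suc j p) (dpow-suc i q) ⟩
        suc p * j ^ p * (suc q * i ^ q)     ≤⟨ *-mono-≤ (*-monoˡ-≤ (j ^ p) p<i)
            (*-monoˡ-≤ (i ^ q) q<j) ⟩
        i * j ^ p * (j * i ^ q)             ≡⟨ eq′ i (j ^ p) j (i ^ q) ⟩
        functions (suc p) (suc q)           ∎
        where
        eq′ : ∀ a b c d → a * b * (c * d) ≡ c * b * (a * d)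
        eq′ = solve-∀

    forests≤functions : ∀ p q → forests p q ≤ functions p q
    forests≤functions p q = m∸n≤m (functions p q) (dpow j p * dpow i q)

    -- By `forests-step` the total weight telescopes.
    pathSum-one : ∀ p q s → p ≤ i → q ≤ j → pathSum (_^ 0) p q s ≤ functions p q
    pathSum-one zero    q       s _ _ = ≤-trans (≤-reflexive (*-identityʳ (forests 0 q)))
        (forests≤functions 0 q)
    pathSum-one (suc p) zero    s _ _ = ≤-trans (≤-reflexive (*-identityʳ (forests (suc p) 0)))
        (forests≤functions (suc p) 0)
    pathSum-one (suc p) (suc q) s p<i q<j = ≤-trans
      (+-mono-≤ (≤-reflexive (*-identityʳ (forests (suc p) (suc q))))
                (*-monoʳ-≤ (suc p * suc q) (pathSum-one p q (suc s) (<⇒≤ p<i) (<⇒≤ q<j))))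
      (forests-step p<i q<j)

    private
      pathSum⁻ : (ℕ → ℕ) → ℕ → ℕ → ℕ → ℕ
      pathSum⁻ g zero    q       s = 0
      pathSum⁻ g (suc p) zero    s = 0
      pathSum⁻ g (suc p) (suc q) s = suc p * suc q * pathSum g p q (suc s)

      pathSum-split : ∀ g p q s → pathSum g p q s ≡ forests p q * g s + pathSum⁻ g p q s
      pathSum-split g zero    q       s = sym (+-identityʳ _)
      pathSum-split g (suc p) zero    s = sym (+-identityʳ _)
      pathSum-split g (suc p) (suc q) s = refl

      -- A discrete mean value inequality, with the derivative taken at the right end point.
      power-step : ∀ s m → suc s ^ suc m ≤ s ^ suc m + suc m * suc s ^ m
      power-step s zero    = ≤-reflexive (eq s)
        where
        eq : ∀ s → suc s * 1 ≡ s * 1 + 1 * 1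
        eq = solve-∀
      power-step s (suc m) = begin
        suc s * suc s ^ suc m                            ≡⟨⟩
        suc s ^ suc m + s * suc s ^ suc m
            ≤⟨ +-monoʳ-≤ (suc s ^ suc m) (*-monoʳ-≤ s (power-step s m)) ⟩
        suc s ^ suc m + s * (s ^ suc m + suc m * P)      ≤⟨ m≤m+n _ (suc m * P) ⟩
        suc s * P + s * (s ^ suc m + suc m * P) + suc m * P ≡⟨ eq s P (s ^ suc m) m ⟩
        s * s ^ suc m + suc (suc m) * (suc s * P)        ∎
        where
        open ≤-Reasoning
        P = suc s ^ m
        eq : ∀ s p z m → suc s * p + s * (z + suc m * p) + suc m * p ≡ s * z + suc (suc m)
            * (suc s * p)
        eq = solve-∀

    -- Summation by parts: forests p q is the decrement of the tail functions p q.
    pathSum-moment-from : ∀ m p q s → p + s ≤ i → q ≤ j →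
      pathSum (_^ suc (suc m)) p q s ≤
      functions p q * s ^ suc (suc m) + suc (suc m) * i * pathSum⁻ (_^ m) p q s
    pathSum-moment-from m zero    q       s _ _ =
      ≤-trans (*-monoˡ-≤ (s ^ suc (suc m)) (forests≤functions 0 q)) (m≤m+n _ _)
    pathSum-moment-from m (suc p) zero    s _ _ =
      ≤-trans (*-monoˡ-≤ (s ^ suc (suc m)) (forests≤functions (suc p) 0)) (m≤m+n _ _)
    pathSum-moment-from m (suc p) (suc q) s p+s<i q<j = begin
      φ * z + pq * pathSum (_^ suc (suc m)) p q (suc s)
        ≤⟨ +-monoʳ-≤ (φ * z) (*-monoʳ-≤ pq (pathSum-moment-from m p q (suc s) p+s′≤i (<⇒≤ q<j))) ⟩
      φ * z + pq * (ψ * suc s ^ suc (suc m) + mi * t)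
        ≤⟨ +-monoʳ-≤ (φ * z) (*-monoʳ-≤ pq (+-monoˡ-≤ (mi * t)
            (*-monoʳ-≤ ψ (power-step s (suc m))))) ⟩
      φ * z + pq * (ψ * (z + suc (suc m) * (suc s * P)) + mi * t)
        ≡⟨ eq₁ φ z pq ψ (suc (suc m)) s P i t ⟩
      (φ + pq * ψ) * z + suc (suc m) * pq * (suc s * ψ * P + i * t)
        -- The factor `suc s` is traded for `i` times the decrement `forests p q`; together with `t`
        -- this restores the m-th moment one level further up the path.
        ≤⟨ +-mono-≤ (*-monoˡ-≤ z (forests-step (≤-trans (m≤m+n (suc p) s) p+s<i) q<j))
                    (*-monoʳ-≤ (suc (suc m) * pq) (+-monoˡ-≤ (i * t)
                      (*-monoˡ-≤ P (functions-forests {p} {q} {suc s} p+s′≤i (<⇒≤ q<j))))) ⟩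
      functions (suc p) (suc q) * z + suc (suc m) * pq * (i * forests p q * P + i * t)
        ≡⟨ cong (functions (suc p) (suc q) * z ℕ.+_)
            (trans (eq₂ (suc (suc m)) pq i (forests p q) P t)
             (cong (λ u → mi * (pq * u)) (sym (pathSum-split (_^ m) p q (suc s))))) ⟩
      functions (suc p) (suc q) * z + mi * (pq * pathSum (_^ m) p q (suc s)) ∎
      where
      open ≤-Reasoning
      p+s′≤i = ≤-trans (≤-reflexive (+-suc p s)) p+s<i
      φ = forests (suc p) (suc q)
      ψ = functions p q
      z = s ^ suc (suc m)
      P = suc s ^ m
      pq = suc p * suc q
      mi = suc (suc m) * i
      t = pathSum⁻ (_^ m) p q (suc s)
      eq₁ : ∀ φ z pq ψ m s P i t →
        φ * z + pq * (ψ * (z + m * (suc s * P)) + m * i * t) ≡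
        (φ + pq * ψ) * z + m * pq * (suc s * ψ * P + i * t)
      eq₁ = solve-∀
      eq₂ : ∀ m pq i f P t → m * pq * (i * f * P + i * t) ≡ m * i * (pq * (f * P + t))
      eq₂ = solve-∀

    -- At s = 0 the boundary term contains a positive power of 0 and vanishes. For this reason
    -- moments are bounded only for sums that start with s = 0.
    pathSum-moment : ∀ m p q → p ≤ i → q ≤ j →
      pathSum (_^ suc (suc m)) p q 0 ≤ suc (suc m) * i * pathSum (_^ m) p q 0
    pathSum-moment m p q p≤i q≤j = begin
      pathSum (_^ suc (suc m)) p q 0
        ≤⟨ pathSum-moment-from m p q 0 (≤-trans (≤-reflexive (+-identityʳ p)) p≤i) q≤j ⟩
      functions p q * 0 + suc (suc m) * i * pathSum⁻ (_^ m) p q 0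
        ≡⟨ cong (_+ suc (suc m) * i * pathSum⁻ (_^ m) p q 0) (*-zeroʳ (functions p q)) ⟩
      suc (suc m) * i * pathSum⁻ (_^ m) p q 0
        ≤⟨ *-monoʳ-≤ (suc (suc m) * i) (m≤n+m _ (forests p q * 0 ^ m)) ⟩
      suc (suc m) * i * (forests p q * 0 ^ m + pathSum⁻ (_^ m) p q 0)
        ≡⟨ cong (suc (suc m) * i *_) (pathSum-split (_^ m) p q 0) ⟨
      suc (suc m) * i * pathSum (_^ m) p q 0 ∎
      where open ≤-Reasoning

    -- Lowering the exponent by two at a time collects the factors 2k, 2k - 2, ..., 2, whose product
    -- is 2^k k!; this is how `k !` arises instead of `(k + k) !`.
    pathSum-even : ∀ k p q → p ≤ i → q ≤ j →
      pathSum (_^ (k + k)) p q 0 ≤ k ! * (2 * i) ^ k * functions p q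
    pathSum-even zero    p q p≤i q≤j = ≤-trans (pathSum-one p q 0 p≤i q≤j)
        (≤-reflexive (sym (*-identityˡ _)))
    pathSum-even (suc k) p q p≤i q≤j = begin
      pathSum (_^ (suc k + suc k)) p q 0
        ≡⟨ cong (λ m → pathSum (_^ suc m) p q 0) (+-suc k k) ⟩
      pathSum (_^ suc (suc (k + k))) p q 0
        ≤⟨ pathSum-moment (k + k) p q p≤i q≤j ⟩
      suc (suc (k + k)) * i * pathSum (_^ (k + k)) p q 0
        ≤⟨ *-monoʳ-≤ (suc (suc (k + k)) * i) (pathSum-even k p q p≤i q≤j) ⟩
      suc (suc (k + k)) * i * (k ! * (2 * i) ^ k * functions p q)
        ≡⟨ eq k i (k !) ((2 * i) ^ k) (functions p q) ⟩
      suc k * k ! * (2 * i * (2 * i) ^ k) * functions p q ∎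
      where
      open ≤-Reasoning
      eq : ∀ k i f e u → suc (suc (k + k)) * i * (f * e * u) ≡ suc k * f * (2 * i * e) * u
      eq = solve-∀

    private
      am-gm-term : ∀ k x s c → 2 * (x * (c * s ^ k)) ≤ c * s ^ (k + k) + x * x * (c * 1)
      am-gm-term k x s c = begin
        2 * (x * (c * s ^ k))              ≡⟨ eq₁ x c (s ^ k) ⟩
        c * (2 * (x * s ^ k))              ≤⟨ *-monoʳ-≤ c (2xy≤x²+y² x (s ^ k)) ⟩
        c * (x * x + s ^ k * s ^ k)        ≡⟨ eq₂ c x (s ^ k * s ^ k) ⟩
        c * (s ^ k * s ^ k) + x * x * (c * 1) ≡⟨ cong (λ z →
            c * z + x * x * (c * 1)) (^-distribˡ-+-* s k k) ⟨
        c * s ^ (k + k) + x * x * (c * 1)  ∎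
        where
        open ≤-Reasoning
        eq₁ : ∀ x c z → 2 * (x * (c * z)) ≡ c * (2 * (x * z))
        eq₁ = solve-∀
        eq₂ : ∀ c x z → c * (x * x + z) ≡ c * z + x * x * (c * 1)
        eq₂ = solve-∀

    -- The inequality `2xy≤x²+y²`, applied to each path with x fixed. In `pathSum-cauchy-schwarz` it
    -- controls the products of the current term with all later ones, x being the power of the
    -- current s.
    pathSum-am-gm : ∀ k x p q s →
      2 * (x * pathSum (_^ k) p q s) ≤
      pathSum (_^ (k + k)) p q s + x * x * pathSum (_^ 0) p q s
    pathSum-am-gm k x zero    q       s = am-gm-term k x s (forests 0 q)
    pathSum-am-gm k x (suc p) zero    s = am-gm-term k x s (forests (suc p) 0)
    pathSum-am-gm k x (suc p) (suc q) s = begin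
      2 * (x * (φ * s ^ k + pq * a))
        ≡⟨ eq₁ x (φ * s ^ k) pq a ⟩
      2 * (x * (φ * s ^ k)) + pq * (2 * (x * a))
        ≤⟨ +-mono-≤ (am-gm-term k x s φ) (*-monoʳ-≤ pq (pathSum-am-gm k x p q (suc s))) ⟩
      φ * s ^ (k + k) + x * x * (φ * 1) + pq * (b + x * x * c)
        ≡⟨ eq₂ (φ * s ^ (k + k)) x φ pq b c ⟩
      φ * s ^ (k + k) + pq * b + x * x * (φ * 1 + pq * c) ∎
      where
      open ≤-Reasoning
      φ = forests (suc p) (suc q)
      pq = suc p * suc q
      a = pathSum (_^ k) p q (suc s)
      b = pathSum (_^ (k + k)) p q (suc s)
      c = pathSum (_^ 0) p q (suc s)
      eq₁ : ∀ x u pq a → 2 * (x * (u + pq * a)) ≡ 2 * (x * u) + pq * (2 * (x * a))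
      eq₁ = solve-∀
      eq₂ : ∀ u x φ pq b c → u + x * x * (φ * 1) + pq * (b + x * x * c) ≡ u + pq * b + x * x
          * (φ * 1 + pq * c)
      eq₂ = solve-∀

    private
      cauchy-schwarz-term : ∀ k s c → (c * s ^ k) * (c * s ^ k) ≤ (c * 1) * (c * s ^ (k + k))
      cauchy-schwarz-term k s c = ≤-reflexive (trans (eq c (s ^ k))
          (cong (λ z → c * 1 * (c * z)) (sym (^-distribˡ-+-* s k k))))
        where
        eq : ∀ c z → (c * z) * (c * z) ≡ (c * 1) * (c * (z * z))
        eq = solve-∀

    pathSum-cauchy-schwarz : ∀ k p q s →
      pathSum (_^ k) p q s * pathSum (_^ k) p q s ≤
      pathSum (_^ 0) p q s * pathSum (_^ (k + k)) p q s
    pathSum-cauchy-schwarz k zero    q       s = cauchy-schwarz-term k s (forests 0 q)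
    pathSum-cauchy-schwarz k (suc p) zero    s = cauchy-schwarz-term k s (forests (suc p) 0)
    pathSum-cauchy-schwarz k (suc p) (suc q) s = begin
      (φ * x + pq * a) * (φ * x + pq * a)
        ≡⟨ eq₁ φ x pq a ⟩
      φ * x * (φ * x) + φ * pq * (2 * (x * a)) + pq * pq * (a * a)
        ≤⟨ +-mono-≤ (+-mono-≤ (cauchy-schwarz-term k s φ)
            (*-monoʳ-≤ (φ * pq) (pathSum-am-gm k x p q (suc s))))
                    (*-monoʳ-≤ (pq * pq) (pathSum-cauchy-schwarz k p q (suc s))) ⟩
      φ * 1 * (φ * y) + φ * pq * (b + x * x * c) + pq * pq * (c * b)
        ≡⟨ cong (λ z → φ * 1 * (φ * y) + φ * pq * (b + z * c) + pq * pq * (c * b))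
            (sym (^-distribˡ-+-* s k k)) ⟩
      φ * 1 * (φ * y) + φ * pq * (b + y * c) + pq * pq * (c * b)
        ≡⟨ eq₂ φ y pq b c ⟩
      (φ * 1 + pq * c) * (φ * y + pq * b) ∎
      where
      open ≤-Reasoning
      φ = forests (suc p) (suc q)
      x = s ^ k
      y = s ^ (k + k)
      pq = suc p * suc q
      a = pathSum (_^ k) p q (suc s)
      b = pathSum (_^ (k + k)) p q (suc s)
      c = pathSum (_^ 0) p q (suc s)
      eq₁ : ∀ φ x pq a → (φ * x + pq * a) * (φ * x + pq * a) ≡ φ * x * (φ * x) + φ * pq
          * (2 * (x * a)) + pq * pq * (a * a)
      eq₁ = solve-∀
      eq₂ : ∀ φ y pq b c → φ * 1 * (φ * y) + φ * pq * (b + y * c) + pq * pq * (c * b)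
          ≡ (φ * 1 + pq * c) * (φ * y + pq * b)
      eq₂ = solve-∀

    pathSum-square : ∀ k p q → p ≤ i → q ≤ j →
      pathSum (_^ k) p q 0 * pathSum (_^ k) p q 0 ≤
      k ! * (2 * i) ^ k * (functions p q * functions p q)
    pathSum-square k p q p≤i q≤j = begin
      pathSum (_^ k) p q 0 * pathSum (_^ k) p q 0         ≤⟨ pathSum-cauchy-schwarz k p q 0 ⟩
      pathSum (_^ 0) p q 0 * pathSum (_^ (k + k)) p q 0
          ≤⟨ *-mono-≤ (pathSum-one p q 0 p≤i q≤j) (pathSum-even k p q p≤i q≤j) ⟩
      functions p q * (k ! * (2 * i) ^ k * functions p q)
          ≡⟨ eq (functions p q) (k ! * (2 * i) ^ k) ⟩
      k ! * (2 * i) ^ k * (functions p q * functions p q) ∎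
      where
      open ≤-Reasoning
      eq : ∀ u v → u * (v * u) ≡ v * (u * u)
      eq = solve-∀

-- Trees, forests and paths

-- The left side is p q M^(p-1) N^(q-1). This is what the bound on forest codes amounts to where
-- there are no codes.
dpow-product≤ : ∀ {p q M N} → p ≤ N → q ≤ M → dpow M p * dpow N q ≤ M ^ p * N ^ q
dpow-product≤ {zero}              _   _   = z≤n
dpow-product≤ {suc p} {zero} {M}  _   _   = ≤-trans (≤-reflexive (*-zeroʳ (dpow M (suc p)))) z≤n
dpow-product≤ {suc p} {suc q} {M} {N} p≤N q≤M = begin
  dpow M (suc p) * dpow N (suc q)      ≡⟨ cong₂ _*_ (dpow-suc M p) (dpow-suc N q) ⟩
  suc p * M ^ p * (suc q * N ^ q)      ≤⟨ *-mono-≤ (*-monoˡ-≤ (M ^ p) p≤N) (*-monoˡ-≤ (N ^ q) q≤M) ⟩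
  N * M ^ p * (M * N ^ q)              ≡⟨ eq N (M ^ p) M (N ^ q) ⟩
  M ^ suc p * N ^ suc q                ∎
  where
  open ≤-Reasoning
  eq : ∀ a b c d → a * b * (c * d) ≡ c * b * (a * d)
  eq = solve-∀

module _ {V : Set} where

  splits : List V → List (List V × List V)
  splits []      = ([] , []) ∷ []
  splits (w ∷ W) = map (λ (S , R) → w ∷ S , R) (splits W) ++ map (λ (S , R) → S , w ∷ R) (splits W)

  splits-length : ∀ W → All (λ (S , R) → length R + length S ≡ length W) (splits W)
  splits-length []      = refl ∷ []
  splits-length (w ∷ W) = All.++⁺
    (All.map⁺ (All.map (λ {(S , R)} e → trans (+-suc (length R) (length S)) (cong suc e))
        (splits-length W)))
    (All.map⁺ (All.map (cong suc) (splits-length W)))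

  ∑-splits : ∀ w W (f : List V × List V → ℕ) →
    ∑ (splits (w ∷ W)) f ≡ ∑ (splits W) (λ (S , R) → f (w ∷ S , R)) + ∑ (splits W) (λ (S , R) →
        f (S , w ∷ R))
  ∑-splits w W f = trans (∑-++ (map (λ (S , R) → w ∷ S , R) (splits W)) _ f)
    (cong₂ _+_ (∑-map _ (splits W) f) (∑-map _ (splits W) f))

  splits-pow : ∀ N W → ∑ (splits W) (λ (S , R) → N ^ length R) ≡ suc N ^ length W
  splits-pow N []      = refl
  splits-pow N (w ∷ W) = trans (∑-splits w W _)
    (cong₂ _+_ (splits-pow N W) (trans (∑-*ˡ N (splits W) _) (cong (N *_) (splits-pow N W))))

  -- The derivative with respect to `N` of the binomial theorem `splits-pow`.
  splits-dpow : ∀ N W → ∑ (splits W) (λ (S , R) → dpow N (length R)) ≡ dpow (suc N) (length W)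
  splits-dpow N []      = refl
  splits-dpow N (w ∷ W) = begin
    ∑ (splits (w ∷ W)) (λ (S , R) → dpow N (length R))
      ≡⟨ ∑-splits w W _ ⟩
    ∑ (splits W) (λ (S , R) → dpow N (length R)) + ∑ (splits W) (λ (S , R) →
        N ^ length R + N * dpow N (length R))
      ≡⟨ cong₂ _+_ (splits-dpow N W) (trans (∑-+ (splits W) _ _) (cong₂ _+_ (splits-pow N W)
           (trans (∑-*ˡ N (splits W) _) (cong (N *_) (splits-dpow N W))))) ⟩
    d + (suc N ^ length W + N * d)
      ≡⟨ eq d (suc N ^ length W) N ⟩
    suc N ^ length W + suc N * d ∎
    where
    open ≡-Reasoning
    d = dpow (suc N) (length W)
    eq : ∀ d p N → d + (p + N * d) ≡ p + suc N * d
    eq = solve-∀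

  picks : List V → List (V × List V)
  picks []       = []
  picks (x ∷ xs) = (x , xs) ∷ map (λ (y , ys) → y , x ∷ ys) (picks xs)

  length-picks : ∀ xs → length (picks xs) ≡ length xs
  length-picks []       = refl
  length-picks (x ∷ xs) = cong suc (trans (length-map _ (picks xs)) (length-picks xs))

  picks-length : ∀ xs → All (λ (y , ys) → suc (length ys) ≡ length xs) (picks xs)
  picks-length []       = []
  picks-length (x ∷ xs) = refl ∷ All.map⁺ (All.map (cong suc) (picks-length xs))

  record Pick (x : V) (xs : List V) : Set where
    field
      rest        : List V
      rest∈       : (x , rest) ∈ picks xs
      rest-unique : Unique rest
      x∉rest      : All (x ≢_) rest
      cover       : ∀ {v} → v ∈ xs → v ≡ x ⊎ v ∈ rest
      rest⊆       : ∀ {v} → v ∈ rest → v ∈ xs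

  pick : ∀ {x xs} → Unique xs → x ∈ xs → Pick x xs
  pick (x∉ ∷ u) (here refl) = record
    { rest∈ = here refl ; rest-unique = u ; x∉rest = x∉
    ; cover = λ { (here e) → inj₁ e ; (there m) → inj₂ m } ; rest⊆ = there }
  pick {x} {y ∷ ys} (y∉ ∷ u) (there m) = record
    { rest∈ = there (∈-map⁺ _ rest∈)
    ; rest-unique = All.tabulate (λ v∈ → All.lookup y∉ (rest⊆ v∈)) ∷ rest-unique
    ; x∉rest = (λ x≡y → All.lookup y∉ m (sym x≡y)) ∷ x∉rest
    ; cover = λ { (here e) → inj₂ (here e) ; (there v∈) → Sum.map₂ there (cover v∈) }
    ; rest⊆ = λ { (here e) → here e ; (there v∈) → there (rest⊆ v∈) } }
    where open Pick (pick u m)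

  Assignment : Set
  Assignment = List (V × V)

  expand : (List V → List V → List Assignment) → V → List V → List Assignment
  expand rec x W = concatMap (λ (S , R) → map (map (_, x) S ++_) (rec S R)) (splits W)

  -- The forests with roots A and B and further vertices U and W (A, U on one
  -- side and B, W on the other), as lists of pairs (child , parent): the roots
  -- are explored one after the other, and the children of an explored root
  -- become roots.
  forestCodes : ℕ → (A B U W : List V) → List Assignment
  forestCodes zero    _       _       _  _  = []
  forestCodes (suc n) (x ∷ A) B       U  W  = expand (λ S R → forestCodes n A (S ++ B) U R) x W
  forestCodes (suc n) []      (y ∷ B) U  W  = expand (λ S R → forestCodes n S B R W) y U
  forestCodes (suc n) []      []      [] [] = [] ∷ []
  forestCodes (suc n) []      []      _  _  = []

  length-expand : ∀ rec x W → length (expand rec x W) ≡ ∑ (splits W) (λ (S , R) → length (rec S R))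
  length-expand rec x W = begin
    length (expand rec x W)            ≡⟨ length-as-∑ (expand rec x W) ⟩
    ∑ (expand rec x W) (λ _ → 1)       ≡⟨ ∑-concatMap _ (splits W) _ ⟩
    ∑ (splits W) (λ (S , R) → ∑ (map (map (_, x) S ++_) (rec S R)) (λ _ → 1))
      ≡⟨ ∑-cong (splits W) (λ (S , R) → trans (sym
          (length-as-∑ (map (map (_, x) S ++_) (rec S R)))) (length-map _ (rec S R))) ⟩
    ∑ (splits W) (λ (S , R) → length (rec S R)) ∎
    where open ≡-Reasoning

  -- Summing over the possible sets of children of one root raises N by one, by `splits-pow` and
  -- `splits-dpow`. The other side of the forest enters only through the constants `d` and `e`.
  expand-bound : ∀ rec x W N d e →
    All (λ (S , R) → length (rec S R) + d * dpow N (length R) ≤ e * N ^ length R) (splits W) →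
    length (expand rec x W) + d * dpow (suc N) (length W) ≤ e * suc N ^ length W
  expand-bound rec x W N d e h = begin
    length (expand rec x W) + d * dpow (suc N) (length W)
      ≡⟨ cong₂ _+_ (length-expand rec x W) (trans (cong (d *_) (sym (splits-dpow N W)))
          (sym (∑-*ˡ d (splits W) _))) ⟩
    ∑ (splits W) (λ (S , R) → length (rec S R)) + ∑ (splits W) (λ (S , R) → d * dpow N (length R))
      ≡⟨ ∑-+ (splits W) _ _ ⟨
    ∑ (splits W) (λ (S , R) → length (rec S R) + d * dpow N (length R))
      ≤⟨ ∑-mono h ⟩
    ∑ (splits W) (λ (S , R) → e * N ^ length R)
      ≡⟨ trans (∑-*ˡ e (splits W) _) (cong (e *_) (splits-pow N W)) ⟩
    e * suc N ^ length W ∎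
    where open ≤-Reasoning

  -- Cayley's bound by induction along the exploration: removing the root x lowers N by one and
  -- `expand-bound` raises it again, while M stays the same because the children of x only move from
  -- W to the roots B. With no root left but vertices remaining, the two products are equal and
  -- leave room for no code. The product to be subtracted stands on the left so that no truncated
  -- difference occurs.
  length-forestCodes : ∀ n A B U W {M N} → length W + length B ≡ M → length U + length A ≡ N →
    length (forestCodes n A B U W) + dpow M (length U) * dpow N (length W) ≤ M ^ length U * N
        ^ length W
  length-forestCodes zero    A       B       U  W  refl refl =
      dpow-product≤ (m≤m+n (length U) _) (m≤m+n (length W) _)
  length-forestCodes (suc n) (x ∷ A) B       U  W  {M} {N} eM eN
    rewrite trans (sym eN) (+-suc (length U) (length A)) =
        expand-bound _ x W (length U + length A) (dpow M (length U)) (M ^ length U) (All.map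
          (λ {(S , R)} e → length-forestCodes n A (S ++ B) U R
            (trans (cong (length R ℕ.+_) (length-++ S))
                (trans (sym (+-assoc (length R) (length S) (length B)))
                (trans (cong (_+ length B) e) eM))) refl)
          (splits-length W))
  length-forestCodes (suc n) []      (y ∷ B) U  W  {M} {N} eM eN
    rewrite trans (sym eM) (+-suc (length W) (length B)) = subst₂ _≤_
          (cong (length (expand (λ S R → forestCodes n S B R W) y U) ℕ.+_)
              (*-comm (dpow N (length W)) (dpow (suc M′) (length U))))
          (*-comm (N ^ length W) (suc M′ ^ length U))
          (expand-bound _ y U M′ (dpow N (length W)) (N ^ length W) (All.map
            (λ {(S , R)} e → subst₂ _≤_
              (cong (length (forestCodes n S B R W) ℕ.+_)
                  (*-comm (dpow M′ (length R)) (dpow N (length W))))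
              (*-comm (M′ ^ length R) (N ^ length W))
              (length-forestCodes n S B R W refl
                  (trans e (trans (sym (+-identityʳ (length U))) eN))))
            (splits-length U)))
    where M′ = length W + length B
  length-forestCodes (suc n) []      []      []      []      refl refl = ≤-refl
  length-forestCodes (suc n) []      []      (u ∷ U) W       refl refl =
    dpow-product≤ {suc (length U)} (m≤m+n _ 0) (m≤m+n (length W) 0)
  length-forestCodes (suc n) []      []      []      (w ∷ W) refl refl = z≤n

  -- Ancestors are listed from the parent up to the root. Storing them instead of parents makes
  -- depth a length and spares a proof that climbing terminates. Every right vertex has a parent
  -- since roots are taken on the left.
  record Tree (Ls Rs : List V) : Set where
    field
      ancestors : V → List V
      root      : V
    Child : V → V → Set
    Child v p = ancestors v ≡ p ∷ ancestors p
    depth : V → ℕ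
    depth v = length (ancestors v)
    field
      root-ancestors : ancestors root ≡ []
      left           : ∀ {v} → v ∈ Ls → v ≡ root ⊎ ∃[ p ] Child v p × p ∈ Rs
      right          : ∀ {v} → v ∈ Rs → ∃[ p ] Child v p × p ∈ Ls

    child-depth : ∀ {v p} → Child v p → depth v ≡ suc (depth p)
    child-depth = cong length

    parent-unique : ∀ {v p q} → Child v p → Child v q → p ≡ q
    parent-unique c d = proj₁ (∷-injective (trans (sym c) d))

  module _ {Ls Rs : List V} (T : Tree Ls Rs) where

    open Tree T

    private
      HasParentIn : List V → List V → V → Set
      HasParentIn A U w = ∃[ p ] Child w p × (p ∈ A ⊎ p ∈ U)

      record Split (x : V) (A U W : List V) : Set where
        field
          {S R}  : List V
          split∈ : (S , R) ∈ splits W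
          S-children : All (λ s → Child s x) S
          R-parents  : All (HasParentIn A U) R
          cover  : ∀ {v} → v ∈ W → v ∈ S ⊎ v ∈ R

      split : ∀ {x A U W} → All (HasParentIn (x ∷ A) U) W → Split x A U W
      split [] = record { split∈ = here refl ; S-children = [] ; R-parents = [] ; cover = λ () }
      split {W = w ∷ W} ((p , c , inj₁ (here refl)) ∷ h) = record
        { split∈ = ∈-++⁺ˡ (∈-map⁺ _ split∈) ; S-children = c ∷ S-children ; R-parents = R-parents
        ; cover = λ { (here e) → inj₁ (here e) ; (there m) → Sum.map₁ there (cover m) } }
        where open Split (split h)
      split {W = w ∷ W} ((p , c , inj₁ (there p∈A)) ∷ h) = record
        { split∈ = ∈-++⁺ʳ _ (∈-map⁺ _ split∈) ; S-children = S-children ; R-parents =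
            (p , c , inj₁ p∈A) ∷ R-parents
        ; cover = λ { (here e) → inj₂ (here e) ; (there m) → Sum.map₂ there (cover m) } }
        where open Split (split h)
      split {W = w ∷ W} ((p , c , inj₂ p∈U) ∷ h) = record
        { split∈ = ∈-++⁺ʳ _ (∈-map⁺ _ split∈) ; S-children = S-children ; R-parents =
            (p , c , inj₂ p∈U) ∷ R-parents
        ; cover = λ { (here e) → inj₂ (here e) ; (there m) → Sum.map₂ there (cover m) } }
        where open Split (split h)

      -- Infinite descent: parents lead back and forth between U and W with ever smaller depth.
      no-rootless : ∀ {U W} → All (HasParentIn [] W) U → All (HasParentIn [] U) W →
        ∀ n {v} → depth v < n → v ∈ U ⊎ v ∈ W → ⊥
      no-rootless hU hW (suc n) v<n (inj₁ m) with All.lookup hU m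
      ... | p , c , inj₂ p∈W = no-rootless hU hW n
          (≤-trans (≤-reflexive (sym (child-depth c))) (s≤s⁻¹ v<n)) (inj₂ p∈W)
      no-rootless hU hW (suc n) v<n (inj₂ m) with All.lookup hW m
      ... | p , c , inj₂ p∈U = no-rootless hU hW n
          (≤-trans (≤-reflexive (sym (child-depth c))) (s≤s⁻¹ v<n)) (inj₁ p∈U)

    Assigned : Assignment → V → Set
    Assigned z v = ∃[ p ] (v , p) ∈ z

    record ForestCode (U W : List V) (codes : List Assignment) : Set where
      field
        code     : Assignment
        code∈    : code ∈ codes
        valid    : All (uncurry Child) code
        assigned : ∀ {v} → v ∈ U ⊎ v ∈ W → Assigned code v

    private
      expand-complete : ∀ rec {x A U W} (s : Split x A U W) → let open Split s in
        ForestCode U R (rec S R) → ForestCode U W (expand rec x W)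
      expand-complete rec {x} {A} {U} {W} s f = record
        { code = map (_, x) S ++ code
        ; code∈ = ∈-concatMap⁺ _ (lose split∈ (∈-map⁺ _ code∈))
        ; valid = All.++⁺ (All.map⁺ S-children) valid
        ; assigned = assigned′ }
        where
        open Split s
        open ForestCode f
        assigned′ : ∀ {v} → v ∈ U ⊎ v ∈ W → Assigned (map (_, x) S ++ code) v
        assigned′ (inj₁ m) with p , m′ ← assigned (inj₁ m) = p , ∈-++⁺ʳ _ m′
        assigned′ (inj₂ m) with cover m
        ... | inj₁ m∈S = x , ∈-++⁺ˡ (∈-map⁺ (_, x) m∈S)
        ... | inj₂ m∈R with p , m′ ← assigned (inj₂ m∈R) = p , ∈-++⁺ʳ _ m′

      swap-code : ∀ {U W codes} → ForestCode U W codes → ForestCode W U codes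
      swap-code f = record { code∈ = code∈ ; valid = valid ; assigned = λ m →
          assigned (Sum.swap m) }
        where open ForestCode f

      reroot : ∀ {B W S R} → (∀ {v} → v ∈ W → v ∈ S ⊎ v ∈ R) → ∀ {U} →
        All (HasParentIn B W) U → All (HasParentIn (S ++ B) R) U
      reroot {B} {W} {S} {R} cover = All.map (λ (p , c , m) → p , c , move m)
        where
        move : ∀ {p} → p ∈ B ⊎ p ∈ W → p ∈ S ++ B ⊎ p ∈ R
        move (inj₁ m) = inj₁ (∈-++⁺ʳ S m)
        move (inj₂ m) = Sum.map₁ ∈-++⁺ˡ (cover m)

    -- The tree steers the exploration: `split` reads off the true children of the explored root.
    -- The hypotheses say that no parent of a remaining vertex has been explored yet, and `reroot`
    -- keeps this true when children become roots. Each step removes one vertex from the four lists,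
    -- which accounts for the fuel.
    forestCodes-complete : ∀ n A B U W → length A + length B + (length U + length W) < n →
      All (HasParentIn B W) U → All (HasParentIn A U) W → ForestCode U W (forestCodes n A B U W)
    forestCodes-complete (suc n) (x ∷ A) B U W fuel hU hW =
      expand-complete _ s (forestCodes-complete n A (S ++ B) U R fuel′ (reroot cover hU) R-parents)
      where
      s = split hW
      open Split s
      eq : ∀ a b u r s → a + (s + b) + (u + r) ≡ a + b + (u + (r + s))
      eq = solve-∀
      fuel′ : length A + length (S ++ B) + (length U + length R) < n
      fuel′ = subst (_< n)
        (trans (cong (λ l → length A + length B + (length U + l))
            (sym (All.lookup (splits-length W) split∈)))
          (trans (sym (eq (length A) (length B) (length U) (length R) (length S)))
                 (cong (λ l → length A + l + (length U + length R)) (sym (length-++ S)))))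
        (s≤s⁻¹ fuel)
    forestCodes-complete (suc n) [] (y ∷ B) U W fuel hU hW =
      swap-code (expand-complete _ s (swap-code (forestCodes-complete n S B R W fuel′ R-parents
        (All.map (λ { (p , c , inj₂ m) → p , c , cover m }) hW))))
      where
      s = split hU
      open Split s
      eq : ∀ b r s w → s + b + (r + w) ≡ b + (r + s + w)
      eq = solve-∀
      fuel′ : length S + length B + (length R + length W) < n
      fuel′ = subst (_< n)
        (trans (cong (λ l → length B + (l + length W)) (sym (All.lookup (splits-length U) split∈)))
          (sym (eq (length B) (length R) (length S) (length W))))
        (s≤s⁻¹ fuel)
    forestCodes-complete (suc n) [] [] []      []      _ _ _ = record
      { code∈ = here refl ; valid = [] ; assigned = λ { (inj₁ ()) ; (inj₂ ()) } }
    forestCodes-complete (suc n) [] [] (u ∷ U) W       _ hU hW =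
        ⊥-elim (no-rootless hU hW _ ≤-refl (inj₁ (here refl)))
    forestCodes-complete (suc n) [] [] []      (w ∷ W) _ hU hW =
        ⊥-elim (no-rootless hU hW _ ≤-refl (inj₂ (here refl)))

  -- A path from a vertex up to the root, with a forest rooted on it: a number
  -- s such that the path has length at most 2 s, the root, and the parents of
  -- the other vertices.
  Code : Set
  Code = ℕ × V × Assignment

  assign : V → V → Code → Code
  assign v p (s , r , z) = s , r , (v , p) ∷ z

  rootHere : V → (A B U W : List V) → ℕ → List Code
  rootHere x A B U W s =
    map (λ z → s , x , z) (forestCodes (suc (length A + length B + (length U + length W))) A B U W)

  -- The path constructed so far covers A and B, has s vertices in B, and is
  -- continued upwards from x in A.
  pathCodes : ℕ → V → (A B U W : List V) → ℕ → List Code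
  pathCodes zero    x A B U W s = rootHere x A B U W s
  pathCodes (suc n) x A B U W s = rootHere x A B U W s ++
    concatMap (λ (y , W′) → concatMap (λ (x′ , U′) →
      map (λ c → assign x y (assign y x′ c)) (pathCodes n x′ (x′ ∷ A) (y ∷ B) U′ W′ (suc s)))
      (picks U)) (picks W)

  module _ (i j : ℕ) (g : ℕ → ℕ) where

    private
      weight : Code → ℕ
      weight c = g (proj₁ c)

    ∑-rootHere : ∀ x A B U W s → length U + length A ≡ i → length W + length B ≡ j →
      ∑ (rootHere x A B U W s) weight ≤ forests i j (length U) (length W) * g s
    ∑-rootHere x A B U W s eU eW = begin
      ∑ (rootHere x A B U W s) weight ≡⟨ ∑-map _ codes weight ⟩
      ∑ codes (λ _ → g s)         ≡⟨ ∑-const codes (g s) ⟩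
      length codes * g s          ≤⟨ *-monoˡ-≤ (g s)
          (m+n≤o⇒m≤o∸n (length codes) (length-forestCodes
          (suc (length A + length B + (length U + length W))) A B U W eW eU)) ⟩
      forests i j (length U) (length W) * g s ∎
      where
      open ≤-Reasoning
      codes = forestCodes (suc (length A + length B + (length U + length W))) A B U W

    forests≤pathSum : ∀ p q s → forests i j p q * g s ≤ pathSum i j g p q s
    forests≤pathSum zero    q       s = ≤-refl
    forests≤pathSum (suc p) zero    s = ≤-refl
    forests≤pathSum (suc p) (suc q) s = m≤m+n _ _

    -- With `pred` one formula covers all cases of `pathSum`: where p or q is zero, the product in
    -- front is zero too.
    pathSum-step : ∀ p q s →
      forests i j p q * g s + q * (p * pathSum i j g (pred p) (pred q) (suc s)) ≤ pathSum i j g p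
          q s
    pathSum-step zero    q       s = ≤-reflexive
        (trans (cong (forests i j 0 q * g s ℕ.+_) (*-zeroʳ q)) (+-identityʳ _))
    pathSum-step (suc p) zero    s = ≤-reflexive (+-identityʳ _)
    pathSum-step (suc p) (suc q) s = ≤-reflexive (cong (forests i j (suc p) (suc q) * g s ℕ.+_)
      (eq (suc q) (suc p) (pathSum i j g p q (suc s))))
      where
      eq : ∀ a b c → a * (b * c) ≡ b * a * c
      eq = solve-∀

    ∑-picks : ∀ xs (f : V × List V → ℕ) {b} → (∀ {y ys} → suc (length ys) ≡ length xs →
        f (y , ys) ≤ b) →
      ∑ (picks xs) f ≤ length xs * b
    ∑-picks xs f {b} h = ≤-trans (∑-mono (All.map h (picks-length xs)))
      (≤-reflexive (trans (∑-const (picks xs) b) (cong (_* b) (length-picks xs))))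

    -- The codes follow the recursion of `pathSum`, with `length W` choices for the parent and
    -- `length U` for the grandparent; moving these two to B and A keeps the totals i and j.
    ∑-pathCodes : ∀ n x A B U W s → length U + length A ≡ i → length W + length B ≡ j →
      ∑ (pathCodes n x A B U W s) weight ≤ pathSum i j g (length U) (length W) s
    ∑-pathCodes zero    x A B U W s eU eW = ≤-trans (∑-rootHere x A B U W s eU eW)
        (forests≤pathSum (length U) (length W) s)
    ∑-pathCodes (suc n) x A B U W s eU eW = begin
      ∑ (pathCodes (suc n) x A B U W s) weight
        ≡⟨ ∑-++ (rootHere x A B U W s) _ weight ⟩
      ∑ (rootHere x A B U W s) weight + ∑ (concatMap (λ (y , W′) →
          concatMap (λ (x′ , U′) → extensions y W′ x′ U′) (picks U)) (picks W)) weight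
        ≤⟨ +-mono-≤ (∑-rootHere x A B U W s eU eW)
            (≤-trans (≤-reflexive (∑-concatMap _ (picks W) weight))
             (∑-picks W _ λ {y} {W′} eW′ → ≤-trans (≤-reflexive (∑-concatMap _ (picks U) weight))
               (∑-picks U _ λ {x′} {U′} eU′ → bound y W′ x′ U′ eW′ eU′))) ⟩
      forests i j (length U) (length W) * g s + length W
          * (length U * pathSum i j g (pred (length U)) (pred (length W)) (suc s))
        ≤⟨ pathSum-step (length U) (length W) s ⟩
      pathSum i j g (length U) (length W) s ∎
      where
      open ≤-Reasoning
      extensions : V → List V → V → List V → List Code
      extensions y W′ x′ U′ = map (λ c → assign x y (assign y x′ c))
          (pathCodes n x′ (x′ ∷ A) (y ∷ B) U′ W′ (suc s))
      bound : ∀ y W′ x′ U′ → suc (length W′) ≡ length W → suc (length U′) ≡ length U →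
        ∑ (extensions y W′ x′ U′) weight ≤ pathSum i j g (pred (length U)) (pred (length W)) (suc s)
      bound y W′ x′ U′ eW′ eU′ = subst₂ (λ p q →
          ∑ (extensions y W′ x′ U′) weight ≤ pathSum i j g (pred p) (pred q) (suc s)) eU′ eW′
        (≤-trans (≤-reflexive (∑-map _ (pathCodes n x′ (x′ ∷ A) (y ∷ B) U′ W′ (suc s)) weight))
          (∑-pathCodes n x′ (x′ ∷ A) (y ∷ B) U′ W′ (suc s)
            (trans (+-suc (length U′) (length A)) (trans (cong (_+ length A) eU′) eU))
            (trans (+-suc (length W′) (length B)) (trans (cong (_+ length B) eW′) eW))))

  -- Every tree has a path code

  module _ {Ls Rs : List V} (T : Tree Ls Rs) where

    open Tree T

    -- The code is correct about `T`, and complete on `P`: it leaves no freedom for the ancestors of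
    -- vertices there once their parents are in `P` as well.
    record Fits (P : V → Set) (c : Code) : Set where
      constructor fits
      field
        root-fits  : ancestors (proj₁ (proj₂ c)) ≡ []
        children   : All (uncurry Child) (proj₂ (proj₂ c))
        determined : ∀ {v} → P v → v ≡ proj₁ (proj₂ c) ⊎ Assigned T (proj₂ (proj₂ c)) v

    fits-assign : ∀ {P v p c} → Child v p → Fits P c → Fits (λ u → u ≡ v ⊎ P u) (assign v p c)
    fits-assign ch (fits r cs d) = fits r (ch ∷ cs) λ
      { (inj₁ refl) → inj₂ (_ , here refl)
      ; (inj₂ Pu) → Sum.map₂ (λ (q , m) → q , there m) (d Pu) }

    fits-⊆ : ∀ {P Q c} → (∀ {v} → Q v → P v) → Fits P c → Fits Q c
    fits-⊆ Q⊆P (fits r cs d) = fits r cs (λ q → d (Q⊆P q))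

    -- The two depth bounds keep the path from meeting itself: the next two ancestors of x have
    -- smaller depth than everything in A and B, so they are still in W and U.
    record PathState (x : V) (A B U W : List V) : Set where
      field
        x∈Ls     : x ∈ Ls
        x∉U      : All (x ≢_) U
        U-unique : Unique U
        W-unique : Unique W
        U⊆Ls     : ∀ {u} → u ∈ U → u ∈ Ls
        W⊆Rs     : ∀ {w} → w ∈ W → w ∈ Rs
        Ls-cover : ∀ {v} → v ∈ Ls → v ∈ A ⊎ v ∈ U
        Rs-cover : ∀ {v} → v ∈ Rs → v ∈ B ⊎ v ∈ W
        A-below  : ∀ {a} → a ∈ A → depth x ≤ depth a
        B-below  : ∀ {b} → b ∈ B → depth x < depth b

    private
      Open : V → List V → List V → V → Set
      Open x U W v = v ≡ x ⊎ v ∈ U ⊎ v ∈ W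

    -- The code follows the true path of `T`. A double step lowers `depth x` by two and raises s by
    -- one, so `depth x + 2 * s` does not change, and at the root it is twice the number stored in
    -- the code. Each double step uses up a vertex of U, which bounds the recursion.
    pathCodes-complete : ∀ n x A B U W s → length U ≤ n → PathState x A B U W →
      ∃[ c ] c ∈ pathCodes n x A B U W s × Fits (Open x U W) c × depth x + 2 * s ≤ 2 * proj₁ c
    pathCodes-complete n x A B U W s U≤n st with left (PathState.x∈Ls st)
    ... | inj₁ refl = (s , x , code) , rootHere⊆ n (∈-map⁺ _ code∈) ,
          fits root-ancestors valid (λ { (inj₁ e) → inj₁ e ; (inj₂ m) → inj₂ (assigned m) }) ,
          ≤-reflexive (cong (λ a → length a + 2 * s) root-ancestors)
      where
      open PathState st
      U-parent : ∀ {u} → u ∈ U → u ≡ root ⊎ (∃[ p ] Child u p × p ∈ Rs) →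
          ∃[ p ] Child u p × (p ∈ B ⊎ p ∈ W)
      U-parent u∈ (inj₁ refl)           = ⊥-elim (All.lookup x∉U u∈ refl)
      U-parent u∈ (inj₂ (p , c , p∈)) = p , c , Rs-cover p∈
      W-parent : ∀ {w} → (∃[ p ] Child w p × p ∈ Ls) → ∃[ p ] Child w p × (p ∈ A ⊎ p ∈ U)
      W-parent (p , c , p∈) = p , c , Ls-cover p∈
      forestCode = forestCodes-complete T _ A B U W ≤-refl
        (All.tabulate λ u∈ → U-parent u∈ (left (U⊆Ls u∈)))
        (All.tabulate λ w∈ → W-parent (right (W⊆Rs w∈)))
      open ForestCode forestCode
      rootHere⊆ : ∀ n {c} → c ∈ rootHere x A B U W s → c ∈ pathCodes n x A B U W s
      rootHere⊆ zero    m = m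
      rootHere⊆ (suc n) m = ∈-++⁺ˡ m
    ... | inj₂ (y , cy , y∈Rs) with right y∈Rs
    ...   | x′ , cx′ , x′∈Ls = continue n U≤n (PathState.Ls-cover st x′∈Ls)
        (PathState.Rs-cover st y∈Rs)
      where
      open PathState st
      x′<y : depth x′ < depth y
      x′<y = ≤-reflexive (sym (child-depth cx′))
      y<x : depth y < depth x
      y<x = ≤-reflexive (sym (child-depth cy))
      continue : ∀ n → length U ≤ n → x′ ∈ A ⊎ x′ ∈ U → y ∈ B ⊎ y ∈ W →
        ∃[ c ] c ∈ pathCodes n x A B U W s × Fits (Open x U W) c × depth x + 2 * s ≤ 2 * proj₁ c
      continue n U≤n (inj₁ x′∈A) _ = ⊥-elim (<⇒≱ (<-trans x′<y y<x) (A-below x′∈A))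
      continue n U≤n (inj₂ _) (inj₁ y∈B) = ⊥-elim (<-asym y<x (B-below y∈B))
      continue zero U≤n (inj₂ x′∈U) (inj₂ y∈W) = ⊥-elim (no-member x′∈U U≤n)
        where
        no-member : ∀ {v} {xs : List V} → v ∈ xs → length xs ≤ 0 → ⊥
        no-member (here _)  ()
        no-member (there _) ()
      continue (suc n) U≤n (inj₂ x′∈U) (inj₂ y∈W) =
        assign x y (assign y x′ c) ,
        ∈-++⁺ʳ (rootHere x A B U W s) (∈-concatMap⁺ _
            (lose PW.rest∈ (∈-concatMap⁺ _ (lose PU.rest∈ (∈-map⁺ _ c∈))))) ,
        fits-⊆ open⊆ (fits-assign cy (fits-assign cx′ c-fits)) ,
        subst (_≤ 2 * proj₁ c) depth-eq le
        where
        module PU = Pick (pick U-unique x′∈U)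
        module PW = Pick (pick W-unique y∈W)
        U′≤n : length PU.rest ≤ n
        U′≤n = s≤s⁻¹ (≤-trans (≤-reflexive (All.lookup (picks-length U) PU.rest∈)) U≤n)
        rec = pathCodes-complete n x′ (x′ ∷ A) (y ∷ B) PU.rest PW.rest (suc s) U′≤n record
          { x∈Ls = x′∈Ls
          ; x∉U = PU.x∉rest
          ; U-unique = PU.rest-unique
          ; W-unique = PW.rest-unique
          ; U⊆Ls = λ m → U⊆Ls (PU.rest⊆ m)
          ; W⊆Rs = λ m → W⊆Rs (PW.rest⊆ m)
          ; Ls-cover = λ m → [ (λ m → inj₁ (there m)) , (λ m →
              Sum.map₁ here (PU.cover m)) ]′ (Ls-cover m)
          ; Rs-cover = λ m → [ (λ m → inj₁ (there m)) , (λ m →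
              Sum.map₁ here (PW.cover m)) ]′ (Rs-cover m)
          ; A-below = λ { (here refl) → ≤-refl ; (there m) →
              ≤-trans (<⇒≤ (<-trans x′<y y<x)) (A-below m) }
          ; B-below = λ { (here refl) → x′<y ; (there m) →
              <-trans (<-trans x′<y y<x) (B-below m) } }
        c = proj₁ rec
        c∈ = proj₁ (proj₂ rec)
        c-fits = proj₁ (proj₂ (proj₂ rec))
        le = proj₂ (proj₂ (proj₂ rec))
        open⊆ : ∀ {v} → Open x U W v → v ≡ x ⊎ v ≡ y ⊎ Open x′ PU.rest PW.rest v
        open⊆ (inj₁ e)         = inj₁ e
        open⊆ (inj₂ (inj₁ m)) = inj₂ (inj₂ (Sum.map₂ inj₁ (PU.cover m)))
        open⊆ (inj₂ (inj₂ m)) = inj₂ ([ inj₁ , (λ m → inj₂ (inj₂ (inj₂ m))) ]′ (PW.cover m))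
        shift : ∀ d s → d + 2 * suc s ≡ suc (suc d) + 2 * s
        shift = solve-∀
        depth-eq : depth x′ + 2 * suc s ≡ depth x + 2 * s
        depth-eq = trans (shift (depth x′) s)
          (cong (_+ 2 * s) (sym (trans (child-depth cy) (cong suc (child-depth cx′)))))

  -- Depth moments over pairwise inequivalent trees

  module _ {Ls Rs : List V} where

    Vertices : V → Set
    Vertices v = v ∈ Ls ⊎ v ∈ Rs

    _≈_ : Tree Ls Rs → Tree Ls Rs → Set
    T ≈ T′ = ∀ {v} → Vertices v → Tree.ancestors T v ≡ Tree.ancestors T′ v

    -- Induction on depth: at the recorded root both ancestor lists are empty, and elsewhere the
    -- pair recorded in the code gives both trees the same parent, which is again a vertex.
    fits-determines : ∀ {T T′ : Tree Ls Rs} {c} → Fits T Vertices c → Fits T′ Vertices c → T ≈ T′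
    fits-determines {T} {T′} {c} (fits r cs d) (fits r′ cs′ _) v∈ = go _ v∈ ≤-refl
      where
      open Tree T
      parent∈ : ∀ {v p} → Vertices v → Child v p → Vertices p
      parent∈ (inj₁ m) ch with left m
      ... | inj₁ refl with () ← trans (sym root-ancestors) ch
      ... | inj₂ (q , ch′ , q∈) = inj₂ (subst (_∈ Rs) (parent-unique ch′ ch) q∈)
      parent∈ (inj₂ m) ch with q , ch′ , q∈ ← right m = inj₁ (subst (_∈ Ls) (parent-unique ch′ ch) q∈)
      go : ∀ n {v} → Vertices v → depth v ≤ n → ancestors v ≡ Tree.ancestors T′ v
      go n v∈ v≤n with d v∈
      ... | inj₁ refl = trans r (sym r′)
      go n v∈ v≤n | inj₂ (p , m) with All.lookup cs m
      go zero    v∈ v≤n | inj₂ (p , m) | ch with () ← ≤-trans (≤-reflexive (sym (child-depth ch))) v≤n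
      go (suc n) v∈ v≤n | inj₂ (p , m) | ch = trans ch (trans
        (cong (p ∷_) (go n (parent∈ v∈ ch) (s≤s⁻¹
            (≤-trans (≤-reflexive (sym (child-depth ch))) v≤n))))
        (sym (All.lookup cs′ m)))

    module _ (Ls-unique : Unique Ls) (Rs-unique : Unique Rs) (k : ℕ)
             {ts : List (Tree Ls Rs)} (separated : AllPairs (λ T T′ → ¬ T ≈ T′) ts) where

      private
        i = length Ls
        j = length Rs

      -- Inequivalent trees cannot fit the same code, so `∑-injection` applies. The factor `2 ^ k`
      -- arises because codes record half of the path length.
      ∑-depth-codes : ∀ v (codes : List Code) →
        (∀ T → ∃[ c ] c ∈ codes × Fits T Vertices c × Tree.depth T v ≤ 2 * proj₁ c) →
        ∑ ts (λ T → Tree.depth T v ^ k) ≤ 2 ^ k * ∑ codes (λ c → proj₁ c ^ k)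
      ∑-depth-codes v codes complete = begin
        ∑ ts (λ T → Tree.depth T v ^ k)
          ≤⟨ ∑-injection (λ T c → Fits T Vertices c)
               (AllPairs.map (λ T≉T′ c f f′ → T≉T′ (fits-determines f f′)) separated)
               (All.tabulate λ {T} _ → let (c , c∈ , f , le) = complete T in
                 lose c∈ (f , ≤-trans (^-monoˡ-≤ k le)
                     (≤-reflexive (^-distribʳ-* k 2 (proj₁ c))))) ⟩
        ∑ codes (λ c → 2 ^ k * proj₁ c ^ k)
          ≡⟨ ∑-*ˡ (2 ^ k) codes _ ⟩
        2 ^ k * ∑ codes (λ c → proj₁ c ^ k) ∎
        where open ≤-Reasoning

      ∑-depth-left : ∀ {v} → v ∈ Ls →
        ∑ ts (λ T → Tree.depth T v ^ k) ≤ 2 ^ k * pathSum i j (_^ k) (pred i) j 0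
      ∑-depth-left {v} v∈ = ≤-trans (∑-depth-codes v codes complete) (*-monoʳ-≤ (2 ^ k)
          (≤-trans (∑-pathCodes i j (_^ k) (length rest) v (v ∷ []) [] rest Rs 0
                     (trans (+-comm (length rest) 1) rest-length) (+-identityʳ j))
                   (≤-reflexive (cong (λ p → pathSum i j (_^ k) (pred p) j 0) rest-length))))
        where
        open Pick (pick Ls-unique v∈)
        codes = pathCodes (length rest) v (v ∷ []) [] rest Rs 0
        rest-length = All.lookup (picks-length Ls) rest∈
        complete : ∀ T → ∃[ c ] c ∈ codes × Fits T Vertices c × Tree.depth T v ≤ 2 * proj₁ c
        complete T with c , c∈ , f , le ← pathCodes-complete T (length rest) v (v ∷ []) [] rest Rs 0 ≤-refl record
            { x∈Ls = v∈ ; x∉U = x∉rest ; U-unique = rest-unique ; W-unique = Rs-unique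
            ; U⊆Ls = rest⊆ ; W⊆Rs = λ m → m ; Ls-cover = λ m →
                Sum.map₁ here (cover m) ; Rs-cover = inj₂
            ; A-below = λ { (here refl) → ≤-refl } ; B-below = λ () }
          = c , c∈ , fits-⊆ T (λ { (inj₁ m) → Sum.map₂ inj₁ (cover m) ; (inj₂ m) →
              inj₂ (inj₂ m) }) f ,
            ≤-trans (≤-reflexive (sym (+-identityʳ (Tree.depth T v)))) le

      -- `pathCodes` continues from a left vertex, so the parent of v is chosen beforehand. This
      -- costs the factor i, and the count s starts at 1 because v itself already belongs to the
      -- path.
      ∑-depth-right : ∀ {v} → v ∈ Rs →
        ∑ ts (λ T → Tree.depth T v ^ k) ≤ 2 ^ k * (i * pathSum i j (_^ k) (pred i) (pred j) 1)
      ∑-depth-right {v} v∈ = ≤-trans (∑-depth-codes v codes complete) (*-monoʳ-≤ (2 ^ k)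
          (≤-trans (≤-reflexive (∑-concatMap _ (picks Ls) _))
              (∑-picks i j (_^ k) Ls _ λ {x} {U} eU →
            ≤-trans (≤-reflexive (∑-map _ (pathCodes (length U) x (x ∷ []) (v ∷ []) U rest 1) _))
              (≤-trans (∑-pathCodes i j (_^ k) (length U) x (x ∷ []) (v ∷ []) U rest 1
                         (trans (+-comm (length U) 1) eU)
                             (trans (+-comm (length rest) 1) rest-length))
                       (≤-reflexive (cong₂ (λ p q → pathSum i j (_^ k) (pred p) (pred q) 1) eU
                           rest-length))))))
        where
        open Pick (pick Rs-unique v∈)
        codes = concatMap (λ (x , U) → map (assign v x)
            (pathCodes (length U) x (x ∷ []) (v ∷ []) U rest 1)) (picks Ls)
        rest-length = All.lookup (picks-length Rs) rest∈
        complete : ∀ T → ∃[ c ] c ∈ codes × Fits T Vertices c × Tree.depth T v ≤ 2 * proj₁ c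
        complete T with x , v-child , x∈ ← Tree.right T v∈
          with (record { rest = U ; rest∈ = U∈ ; rest-unique = U-unique ; x∉rest = x∉U ; cover = U-cover ; rest⊆ = U⊆ })
                 ← pick Ls-unique x∈
          with c , c∈ , f , le ← pathCodes-complete T (length U) x (x ∷ []) (v ∷ []) U rest 1 ≤-refl record
            { x∈Ls = x∈ ; x∉U = x∉U ; U-unique = U-unique ; W-unique = rest-unique
            ; U⊆Ls = U⊆ ; W⊆Rs = rest⊆ ; Ls-cover = λ m → Sum.map₁ here (U-cover m)
            ; Rs-cover = λ m → Sum.map₁ here (cover m)
            ; A-below = λ { (here refl) → ≤-refl }
            ; B-below = λ { (here refl) → ≤-reflexive (sym (Tree.child-depth T v-child)) } }
          = assign v x c , ∈-concatMap⁺ _ (lose U∈ (∈-map⁺ _ c∈)) ,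
            fits-⊆ T (λ { (inj₁ m) → inj₂ (Sum.map₂ inj₁ (U-cover m))
                        ; (inj₂ m) → [ inj₁ , (λ m → inj₂ (inj₂ (inj₂ m))) ]′ (cover m) })
                     (fits-assign T v-child f) ,
            -- The path from a right vertex has odd length, so rounding up to `2 * s` loses one.
            ≤-trans (≤-trans (≤-reflexive (Tree.child-depth T v-child)) (m≤n⇒m≤1+n (≤-refl)))
                (≤-trans (≤-reflexive (+-comm 2 (Tree.depth T x))) le)

-- Depth-first search

length-─ : ∀ {A : Set} {P : A → Set} {xs : List A} (m : Any P xs) →
    suc (length (xs Any.─ m)) ≡ length xs
length-─ (here _)                = refl
length-─ {xs = x ∷ y ∷ xs} (there m) = cong suc (length-─ m)

∈-─ : ∀ {A : Set} {v y : A} {xs} (m : y ∈ xs) → v ∈ xs → v ≡ y ⊎ v ∈ (xs Any.─ m)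
∈-─ (here refl) (here e)  = inj₁ e
∈-─ (here refl) (there p) = inj₂ p
∈-─ (there m)   (here e)  = inj₂ (here e)
∈-─ (there m)   (there p) = Sum.map₂ there (∈-─ m p)

module DepthFirstSearch
  {V : Set} (_≟_ : ∀ (u v : V) → Dec (u ≡ v))
  {Adj : V → V → Set} (adj? : ∀ u v → Dec (Adj u v))
  (adj-sym : ∀ {u v} → Adj u v → Adj v u) (adj-irrefl : ∀ {v} → ¬ Adj v v)
  (root : V) (reachable : ∀ v → Star Adj root v)
  (vertices : List V) (∈-vertices : ∀ v → v ∈ vertices)
  where

  private
    -- Discovered vertices carry their ancestor lists. By `top` the stack below its first vertex is
    -- the ancestor list of that vertex, so being on the stack means being an ancestor of the vertex
    -- about to be discovered. `unseen` must contain every undiscovered vertex but may contain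
    -- others; at the start it contains the root.
    record State : Set where
      field
        discovered : List (V × List V)
        stack      : List V
        unseen     : List V
      Discovered : V → Set
      Discovered v = ∃[ a ] (v , a) ∈ discovered
      field
        functional : ∀ {v a b} → (v , a) ∈ discovered → (v , b) ∈ discovered → a ≡ b
        tree       : ∀ {v a} → (v , a) ∈ discovered →
                     (v ≡ root × a ≡ []) ⊎ (∃[ p ] ∃[ b ] a ≡ p ∷ b × (p , b) ∈ discovered × Adj v
                         p)
        comparable : ∀ {v a w b} → (v , a) ∈ discovered → (w , b) ∈ discovered → Adj v w →
            v ∈ b ⊎ w ∈ a
        finished   : ∀ {v a} → (v , a) ∈ discovered → v ∈ stack ⊎ (∀ {w} → Adj v w → Discovered w)
        top        : ∀ {x a} → stack ≡ x ∷ a → (x , a) ∈ discovered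
        root∈      : (root , []) ∈ discovered
        seen       : ∀ v → Discovered v ⊎ v ∈ unseen

      discovered? : ∀ v → Dec (Discovered v)
      discovered? v = map′ to from (Any.any? (λ (w , _) → v ≟ w) discovered)
        where
        to : ∀ {xs} → Any (λ (w , _) → v ≡ w) xs → ∃[ a ] (v , a) ∈ xs
        to (here {x = _ , a} refl) = a , here refl
        to (there m) with a , m′ ← to m = a , there m′
        from : ∀ {xs} → (∃[ a ] (v , a) ∈ xs) → Any (λ (w , _) → v ≡ w) xs
        from (_ , here refl) = here refl
        from (a , there m)   = there (from (a , m))

    open State

    initial : State
    initial = record
      { discovered = (root , []) ∷ [] ; stack = root ∷ [] ; unseen = vertices
      ; functional = λ { (here refl) (here refl) → refl }
      ; tree = λ { (here refl) → inj₁ (refl , refl) }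
      ; comparable = λ { (here refl) (here refl) a → ⊥-elim (adj-irrefl a) }
      ; finished = λ { (here refl) → inj₁ (here refl) }
      ; top = λ { refl → here refl }
      ; root∈ = here refl
      ; seen = λ v → inj₂ (∈-vertices v) }

    push : ∀ (s : State) {x a y} → stack s ≡ x ∷ a → Adj x y → ¬ Discovered s y → y ∈ unseen s →
        State
    push s {x} {a} {y} e x~y new m = record
      { discovered = (y , x ∷ a) ∷ discovered s ; stack = y ∷ x ∷ a ; unseen = unseen s Any.─ m
      ; functional = λ { (here refl) (here refl) → refl
                       ; (here refl) (there q) → ⊥-elim (new (_ , q))
                       ; (there p) (here refl) → ⊥-elim (new (_ , p))
                       ; (there p) (there q) → functional s p q }
      ; tree = λ { (here refl) → inj₂ (x , a , refl , there (top s e) , adj-sym x~y)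
                 ; (there p) → Sum.map₂ (λ (q , b , eq , q∈ , v~q) →
                     q , b , eq , there q∈ , v~q) (tree s p) }
      ; comparable = λ { (here refl) (here refl) y~y → ⊥-elim (adj-irrefl y~y)
                       ; (here refl) (there q) y~w → inj₂ (ancestor q (adj-sym y~w))
                       ; (there p) (here refl) v~y → inj₁ (ancestor p v~y)
                       ; (there p) (there q) v~w → comparable s p q v~w }
      ; finished = λ { (here refl) → inj₁ (here refl)
                     ; (there p) → Sum.map (λ v∈ → there (subst (_ ∈_) e v∈))
                                           (λ f v~w → proj₁ (f v~w) , there (proj₂ (f v~w)))
                                               (finished s p) }
      ; top = λ { refl → here refl }
      ; root∈ = there (root∈ s)
      ; seen = λ v → [ (λ (b , v∈) → inj₁ (b , there v∈)) ,
                       (λ v∈ → Sum.map₁ (λ { refl → _ , here refl }) (∈-─ m v∈)) ]′ (seen s v) }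
      where
      -- A discovered neighbour of the new vertex is still on the stack: once it has left, all its
      -- neighbours are discovered, and y would not be new. This is why every edge joins comparable
      -- vertices.
      ancestor : ∀ {w b} → (w , b) ∈ discovered s → Adj w y → w ∈ x ∷ a
      ancestor p w~y with finished s p
      ... | inj₁ w∈ = subst (_ ∈_) e w∈
      ... | inj₂ f  = ⊥-elim (new (f w~y))

    pop : ∀ (s : State) {x a} → stack s ≡ x ∷ a → (∀ {w} → Adj x w → Discovered s w) → State
    pop s {x} {a} e done = record
      { State s
      ; stack = a
      ; finished = λ p → [ (λ v∈ → leave (subst (_ ∈_) e v∈)) , inj₂ ]′ (finished s p)
      ; top = λ { refl → parent (tree s (top s e)) } }
      where
      leave : ∀ {v} → v ∈ x ∷ a → v ∈ a ⊎ (∀ {w} → Adj v w → Discovered s w)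
      leave (here refl) = inj₂ done
      leave (there v∈)  = inj₁ v∈
      parent : ∀ {y b} → (x ≡ root × y ∷ b ≡ []) ⊎
          (∃[ p ] ∃[ c ] y ∷ b ≡ p ∷ c × (p , c) ∈ discovered s × Adj x p) →
               (y , b) ∈ discovered s
      parent (inj₂ (_ , _ , refl , p∈ , _)) = p∈

    next : ∀ s x → (∃[ y ] Adj x y × ¬ Discovered s y × y ∈ unseen s) ⊎ (∀ {w} → Adj x w →
        Discovered s w)
    next s x with Any.any? (λ y → adj? x y ×-dec ¬? (discovered? s y)) (unseen s)
    ... | yes h with y , y∈ , x~y , new ← find h = inj₁ (y , x~y , new , y∈)
    ... | no ¬h = inj₂ λ {w} x~w → [ (λ d → d) ,
            (λ w∈ → decidable-stable (discovered? s w) λ new →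
                ¬h (lose w∈ (x~w , new))) ]′ (seen s w)

    -- The measure drops by one at every move: a push takes one vertex from `unseen`, which counts
    -- twice, and adds one to the stack; a pop shortens the stack.
    search : ∀ n (s : State) → length (unseen s) + length (unseen s) + length (stack s) ≤ n →
        ∃[ s′ ] stack s′ ≡ []
    search n s fuel with stack s in e
    ... | [] = s , e
    search zero s fuel | x ∷ a with () ← ≤-trans (m≤n+m (suc (length a)) (length (unseen s) + length (unseen s))) fuel
    search (suc n) s fuel | x ∷ a with next s x
    ... | inj₁ (y , x~y , new , y∈) = search n (push s e x~y new y∈)
        (s≤s⁻¹ (≤-trans (≤-reflexive eq) fuel))
      where
      l = length (unseen s Any.─ y∈)
      eq : suc (l + l + suc (suc (length a))) ≡ length (unseen s) + length (unseen s) + suc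
          (length a)
      eq = trans (arith l (length a)) (cong (λ u → u + u + suc (length a)) (length-─ y∈))
        where
        arith : ∀ l a → suc (l + l + suc (suc a)) ≡ suc l + suc l + suc a
        arith = solve-∀
    ... | inj₂ done = search n (pop s e done) (s≤s⁻¹
        (≤-trans (≤-reflexive (sym (+-suc (length (unseen s) + length (unseen s)) (length a))))
        fuel))

    final : ∃[ s ] stack s ≡ []
    final = search _ initial ≤-refl

    open State (proj₁ final) using () renaming (finished to finished′; tree to tree′; root∈ to root∈′; functional to functional′; comparable to comparable′; Discovered to Discovered′)

    all-discovered : ∀ {u v} → Star Adj u v → Discovered′ u → Discovered′ v
    all-discovered ε d = d
    all-discovered (u~w ◅ s) (a , u∈) with finished′ u∈
    ... | inj₂ f = all-discovered s (f u~w)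
    ... | inj₁ m with () ← subst (_ ∈_) (proj₂ final) m

    discovery : ∀ v → Discovered′ v
    discovery v = all-discovered (reachable v) ([] , root∈′)

  ancestors : V → List V
  ancestors v = proj₁ (discovery v)

  ancestors-root : ancestors root ≡ []
  ancestors-root = functional′ (proj₂ (discovery root)) root∈′

  ancestors-child : ∀ v → v ≡ root ⊎ ∃[ p ] ancestors v ≡ p ∷ ancestors p × Adj v p
  ancestors-child v with tree′ (proj₂ (discovery v))
  ... | inj₁ (e , _) = inj₁ e
  ... | inj₂ (p , b , e , p∈ , v~p) = inj₂ (p , trans e
      (cong (p ∷_) (functional′ p∈ (proj₂ (discovery p)))) , v~p)

  ancestors-comparable : ∀ {u v} → Adj u v → u ∈ ancestors v ⊎ v ∈ ancestors u
  ancestors-comparable {u} {v} = comparable′ (proj₂ (discovery u)) (proj₂ (discovery v))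

-- Counting graphs by their normal trees

elements : ∀ {n} → Subset n → List (Fin n)
elements []            = []
elements (outside ∷ p) = map suc (elements p)
elements (inside ∷ p)  = zero ∷ map suc (elements p)

length-elements : ∀ {n} (p : Subset n) → length (elements p) ≡ ∣ p ∣
length-elements []            = refl
length-elements (outside ∷ p) = trans (length-map suc (elements p)) (length-elements p)
length-elements (inside ∷ p)  = cong suc (trans (length-map suc (elements p)) (length-elements p))

elements-unique : ∀ {n} (p : Subset n) → Unique (elements p)
elements-unique []            = []
elements-unique (outside ∷ p) = Unique.map⁺ Fin.suc-injective (elements-unique p)
elements-unique (inside ∷ p)  =
  All.map⁺ (All.tabulate λ _ ()) ∷ Unique.map⁺ Fin.suc-injective (elements-unique p)

∈-elements⁺ : ∀ {n} {p : Subset n} {x} → x ∈ˢ p → x ∈ elements p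
∈-elements⁺ {p = inside ∷ p}  Vec.here      = here refl
∈-elements⁺ {p = inside ∷ p}  (Vec.there m) = there (∈-map⁺ suc (∈-elements⁺ m))
∈-elements⁺ {p = outside ∷ p} (Vec.there m) = ∈-map⁺ suc (∈-elements⁺ m)

∈-elements⁻ : ∀ {n} {p : Subset n} {x} → x ∈ elements p → x ∈ˢ p
∈-elements⁻ {p = inside ∷ p}  (here refl) = Vec.here
∈-elements⁻ {p = inside ∷ p}  (there m) with y , y∈ , refl ← ∈-map⁻ suc m = Vec.there (∈-elements⁻ y∈)
∈-elements⁻ {p = outside ∷ p} m         with y , y∈ , refl ← ∈-map⁻ suc m = Vec.there (∈-elements⁻ y∈)

subsets-unique : ∀ n → Unique (subsets n)
subsets-unique zero    = [] ∷ []
subsets-unique (suc n) = Unique.++⁺ (Unique.map⁺ (λ { refl → refl }) (subsets-unique n))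
  (Unique.map⁺ (λ { refl → refl }) (subsets-unique n))
  λ (m , m′) → disjoint (∈-map⁻ (outside ∷_) m) (∈-map⁻ (inside ∷_) m′)
  where
  disjoint : ∀ {v : Subset (suc n)} → (∃[ p ] p ∈ subsets n × v ≡ outside ∷ p) →
      (∃[ p ] p ∈ subsets n × v ≡ inside ∷ p) → ⊥
  disjoint (_ , _ , refl) (_ , _ , ())

module _ {A B : Set} where

  pairsWith : (A → List B) → List A → List (A × B)
  pairsWith f = concatMap (λ v → map (v ,_) (f v))

  ∈-pairsWith⁺ : ∀ {f vs v u} → v ∈ vs → u ∈ f v → (v , u) ∈ pairsWith f vs
  ∈-pairsWith⁺ v∈ u∈ = ∈-concatMap⁺ _ (lose v∈ (∈-map⁺ _ u∈))

  ∈-pairsWith⁻ : ∀ f vs {v u} → (v , u) ∈ pairsWith f vs → u ∈ f v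
  ∈-pairsWith⁻ f vs m with find (∈-concatMap⁻ (λ v → map (v ,_) (f v)) {xs = vs} m)
  ... | v′ , _ , m′ with ∈-map⁻ (v′ ,_) m′
  ...   | _ , u∈ , refl = u∈

  length-pairsWith : ∀ f vs → length (pairsWith f vs) ≡ ∑ vs (length ∘ f)
  length-pairsWith f []       = refl
  length-pairsWith f (v ∷ vs) = trans (length-++ (map (v ,_) (f v)))
    (cong₂ _+_ (length-map (v ,_) (f v)) (length-pairsWith f vs))

  pairsWith-unique : ∀ {f vs} → (∀ v → Unique (f v)) → Unique vs → Unique (pairsWith f vs)
  pairsWith-unique             hf []          = []
  pairsWith-unique {f} {v ∷ vs} hf (v∉ ∷ u) = Unique.++⁺
    (Unique.map⁺ (λ { refl → refl }) (hf v)) (pairsWith-unique hf u)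
    λ (m , m′) → disjoint (∈-map⁻ (v ,_) m) (find
        (∈-concatMap⁻ (λ v → map (v ,_) (f v)) {xs = vs} m′))
    where
    disjoint : ∀ {p} → (∃[ u ] u ∈ f v × p ≡ (v , u)) → (∃[ w ] w ∈ vs × p ∈ map (w ,_) (f w)) → ⊥
    disjoint (_ , _ , refl) (w , w∈ , m) with _ , _ , e ← ∈-map⁻ (w ,_) m =
      All.lookup v∉ w∈ (cong proj₁ e)

  pairsWith-⊆ : ∀ {f g} → (∀ v → f v Sublist.⊆ g v) → ∀ vs → pairsWith f vs Sublist.⊆ pairsWith g vs
  pairsWith-⊆ h []       = Sublist.[]
  pairsWith-⊆ h (v ∷ vs) = Sublist.++⁺ (Sublist.map⁺ (v ,_) (h v)) (pairsWith-⊆ h vs)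

module _ {A : Set} {Q : A → Set} {R : A → A → Set} where

  allPairs-with-All : ∀ {xs} → All Q xs → AllPairs R xs → AllPairs (λ x y → Q x × Q y × R x y) xs
  allPairs-with-All []       []       = []
  allPairs-with-All (q ∷ qs) (r ∷ rs) =
    All.map (λ (q′ , r′) → q , q′ , r′) (All.zip (qs , r)) ∷ allPairs-with-All qs rs

length-injection : ∀ {A B : Set} (R : A → B → Set) {xs zs} →
  AllPairs (λ a a′ → ∀ b → R a b → R a′ b → ⊥) xs → All (λ a → Any (R a) zs) xs →
      length xs ≤ length zs
length-injection R {xs} {zs} sep hits = subst₂ _≤_ (sym (length-as-∑ xs)) (sym (length-as-∑ zs))
  (∑-injection R {f = λ _ → 1} {g = λ _ → 1} sep (All.map (Any.map λ r → r , ≤-refl) hits))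

module _ (i j : ℕ) where

  lefts rights allVertices : List (Vertex i j)
  lefts    = map inj₁ (allFin i)
  rights   = map inj₂ (allFin j)
  allVertices = lefts ++ rights

  ∈-lefts : ∀ x → inj₁ x ∈ lefts
  ∈-lefts x = ∈-map⁺ inj₁ (∈-allFin x)

  ∈-rights : ∀ y → inj₂ y ∈ rights
  ∈-rights y = ∈-map⁺ inj₂ (∈-allFin y)

  ∈-allVertices : ∀ v → v ∈ allVertices
  ∈-allVertices (inj₁ x) = ∈-++⁺ˡ (∈-lefts x)
  ∈-allVertices (inj₂ y) = ∈-++⁺ʳ lefts (∈-rights y)

  length-allFin : ∀ n → length (allFin n) ≡ n
  length-allFin n = length-tabulate {n = n} (λ x → x)

  length-lefts : length lefts ≡ i
  length-lefts = trans (length-map inj₁ (allFin i)) (length-allFin i)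

  length-rights : length rights ≡ j
  length-rights = trans (length-map inj₂ (allFin j)) (length-allFin j)

  length-vertices : length allVertices ≡ i + j
  length-vertices = trans (length-++ lefts) (cong₂ _+_ length-lefts length-rights)

  lefts-unique : Unique lefts
  lefts-unique = Unique.map⁺ Sum.inj₁-injective (Unique.allFin⁺ i)

  rights-unique : Unique rights
  rights-unique = Unique.map⁺ Sum.inj₂-injective (Unique.allFin⁺ j)

  vertices-unique : Unique allVertices
  vertices-unique = Unique.++⁺ lefts-unique rights-unique
    λ (m , m′) → disjoint (∈-map⁻ inj₁ m) (∈-map⁻ inj₂ m′)
    where
    disjoint : ∀ {v : Vertex i j} → (∃[ x ] x ∈ allFin i × v ≡ inj₁ x) →
        (∃[ y ] y ∈ allFin j × v ≡ inj₂ y) → ⊥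
    disjoint (_ , _ , refl) (_ , _ , ())

  _≟ᵥ_ : ∀ (u v : Vertex i j) → Dec (u ≡ v)
  _≟ᵥ_ = Sum.≡-dec Fin._≟_ Fin._≟_

  BTree : Set
  BTree = Tree lefts rights

  -- The pair (u , v), in either order, is the edge with index e.
  Joins : Vertex i j × Vertex i j → Fin (i * j) → Set
  Joins p e = ∃[ x ] ∃[ y ] e ≡ combine x y × (p ≡ (inj₁ x , inj₂ y) ⊎ p ≡ (inj₂ y , inj₁ x))

  joins-functional : ∀ {p e e′} → Joins p e → Joins p e′ → e ≡ e′
  joins-functional (x , y , refl , inj₁ refl) (_ , _ , refl , inj₁ refl) = refl
  joins-functional (x , y , refl , inj₂ refl) (_ , _ , refl , inj₂ refl) = refl
  joins-functional (x , y , refl , inj₁ refl) (_ , _ , _ , inj₂ ())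
  joins-functional (x , y , refl , inj₂ refl) (_ , _ , _ , inj₁ ())

  joins-injective : ∀ {u v u′ v′ e} → Joins (u , v) e → Joins (u′ , v′) e →
    (u , v) ≡ (u′ , v′) ⊎ (u , v) ≡ (v′ , u′)
  joins-injective (x , y , refl , p) (x′ , y′ , e , p′) with Fin.combine-injective x y x′ y′ e
  joins-injective (x , y , refl , inj₁ refl) (_ , _ , _ , inj₁ refl) | refl , refl = inj₁ refl
  joins-injective (x , y , refl , inj₁ refl) (_ , _ , _ , inj₂ refl) | refl , refl = inj₂ refl
  joins-injective (x , y , refl , inj₂ refl) (_ , _ , _ , inj₁ refl) | refl , refl = inj₂ refl
  joins-injective (x , y , refl , inj₂ refl) (_ , _ , _ , inj₂ refl) | refl , refl = inj₁ refl

  module _ (T : BTree) where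

    open Tree T

    parent : ∀ v → v ≡ root ⊎ ∃[ p ] Child v p
    parent (inj₁ x) = Sum.map₂ (λ (p , c , _) → p , c) (left (∈-lefts x))
    parent (inj₂ y) = inj₂ (let (p , c , _) = right (∈-rights y) in p , c)

    ancestor-depth : ∀ n {v u} → depth v ≤ n → u ∈ ancestors v → depth u < depth v
    ancestor-depth n {v} v≤n u∈ = go n v≤n u∈ (parent v)
      where
      go : ∀ n {v u} → depth v ≤ n → u ∈ ancestors v → v ≡ root ⊎ ∃[ p ] Child v p →
          depth u < depth v
      go n v≤n u∈ (inj₁ refl) with () ← subst (_ ∈_) root-ancestors u∈
      go n v≤n u∈ (inj₂ (p , c)) with subst (_ ∈_) c u∈
      ... | here refl = ≤-reflexive (sym (child-depth c))
      go zero    v≤n u∈ (inj₂ (p , c)) | there _ with () ← ≤-trans (≤-reflexive (sym (child-depth c))) v≤n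
      go (suc n) v≤n u∈ (inj₂ (p , c)) | there m = <-trans
        (go n (s≤s⁻¹ (≤-trans (≤-reflexive (sym (child-depth c))) v≤n)) m (parent p))
            (≤-reflexive (sym (child-depth c)))

    ancestors-unique : ∀ v → Unique (ancestors v)
    ancestors-unique v = go _ v ≤-refl
      where
      go : ∀ n v → depth v ≤ n → Unique (ancestors v)
      go n v v≤n with ancestors v in e
      ... | [] = []
      go (suc n) v v≤n | p ∷ a with parent v
      ... | inj₁ refl with () ← trans (sym root-ancestors) e
      ... | inj₂ (q , c) with refl , refl ← ∷-injective (trans (sym e) c) =
        All.tabulate (λ {u} u∈ → λ { refl → <-irrefl refl (ancestor-depth _ {q} ≤-refl u∈) })
        ∷ go n q (s≤s⁻¹ v≤n)

    parentPairs : List (Vertex i j × Vertex i j)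
    parentPairs = pairsWith (λ v → take 1 (ancestors v)) allVertices

    -- The possible positions of the edges outside `T`. Ancestors on the vertex's own side are
    -- included, which only enlarges the count.
    candidates : List (Vertex i j × Vertex i j)
    candidates = pairsWith (λ v → drop 1 (ancestors v)) allVertices

    length-candidates : length candidates ≤ ∑ allVertices depth
    length-candidates = ≤-trans (≤-reflexive (length-pairsWith _ allVertices))
      (∑-mono′ allVertices λ v → ≤-trans (≤-reflexive (length-drop 1 (ancestors v))) (m∸n≤m _ 1))

    -- S is the set of edges of G outside T.
    Decodes : BipartiteGraph i j → Fin i → List (Vertex i j × Vertex i j) → Set
    Decodes G r S = ancestors (inj₁ r) ≡ [] × (∀ x y → Linked x y → combine x y ∈ˢ G) × (∀ x y →
        combine x y ∈ˢ G → Linked x y)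
      where
      Linked : Fin i → Fin j → Set
      Linked x y = (inj₁ x , inj₂ y) ∈ parentPairs ++ S ⊎ (inj₂ y , inj₁ x) ∈ parentPairs ++ S

    decodes-root : ∀ {r} → ancestors (inj₁ r) ≡ [] → inj₁ r ≡ root
    decodes-root {r} e with left (∈-lefts r)
    ... | inj₁ e′ = e′
    ... | inj₂ (p , c , _) with () ← trans (sym e) c

    -- Every edge index is of the form `combine x y`, so the pairs linked by `T` and `S` fix the
    -- graph; a left vertex without ancestors can only be the root.
    decodes-functional : ∀ {G r G′ r′ S} → Decodes G r S → Decodes G′ r′ S → (G , r) ≡ (G′ , r′)
    decodes-functional {G} {r} {G′} {r′} {S} (e , to , from) (e′ , to′ , from′) = cong₂ _,_
      (⊆-antisym (λ {k} → include to′ from k) (λ {k} → include to from′ k))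
      (Sum.inj₁-injective (trans (decodes-root e) (sym (decodes-root e′))))
      where
      include : ∀ {H H′ : BipartiteGraph i j} {L : Fin i → Fin j → Set} →
        (∀ x y → L x y → combine x y ∈ˢ H′) → (∀ x y → combine x y ∈ˢ H → L x y) → ∀ k → k ∈ˢ H →
            k ∈ˢ H′
      include to from k k∈ with x , y , refl ← Fin.combine-surjective {i} {j} k = to x y (from x y k∈)

    -- The edges of a graph outside a normal tree

    module Normal (G : BipartiteGraph i j)
      (child-adjacent : ∀ {v p} → Child v p → Adjacent i j G v p)
      (comparable : ∀ {u v} → Adjacent i j G u v → u ∈ ancestors v ⊎ v ∈ ancestors u)
      (r : Fin i) (root≡ : root ≡ inj₁ r)
      where

      excess : List (Vertex i j × Vertex i j)
      excess = pairsWith (λ v → filter (adjacent? i j G v) (drop 1 (ancestors v))) allVertices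

      excess-⊆ : excess Sublist.⊆ candidates
      excess-⊆ = pairsWith-⊆ (λ v → Sublist.filter-⊆ (adjacent? i j G v) (drop 1 (ancestors v)))
          allVertices

      private
        -- The edges of `G`, each directed from descendant to ancestor.
        full : List (Vertex i j × Vertex i j)
        full = pairsWith (λ v → filter (adjacent? i j G v) (ancestors v)) allVertices

        adjacent-edge : ∀ {u v} → Adjacent i j G u v → ∃[ e ] e ∈ˢ G × Joins (u , v) e
        adjacent-edge (l—r {x} {y} m) = combine x y , m , x , y , refl , inj₁ refl
        adjacent-edge (r—l {x} {y} m) = combine x y , m , x , y , refl , inj₂ refl

        ∈-full : ∀ {u v} → v ∈ ancestors u → Adjacent i j G u v → (u , v) ∈ full
        ∈-full {u} v∈ a = ∈-pairsWith⁺ (∈-allVertices u) (∈-filter⁺ (adjacent? i j G u) v∈ a)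

        ∈-full⁻ : ∀ {u v} → (u , v) ∈ full → v ∈ ancestors u × Adjacent i j G u v
        ∈-full⁻ {u} {v} m = ∈-filter⁻ (adjacent? i j G u) {v} {ancestors u}
            (∈-pairsWith⁻ (λ v → filter (adjacent? i j G v) (ancestors v)) allVertices m)

        adjacent-sym : ∀ {u v} → Adjacent i j G u v → Adjacent i j G v u
        adjacent-sym (l—r m) = r—l m
        adjacent-sym (r—l m) = l—r m

        -- Two different pairs on the same edge would be reverses of each other, yet in each the
        -- second vertex has the smaller depth.
        full≤ : length full ≤ length (elements G)
        full≤ = length-injection Joins
          (AllPairs.map (λ { {u , v} {u′ , v′} (d , d′ , ne) e J J′ →
              [ ne , (λ { refl → <-asym d d′ }) ]′ (joins-injective J J′) })
            (allPairs-with-All {Q = λ (u , v) → depth v < depth u}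
              (All.tabulate λ { {u , v} m → ancestor-depth _ ≤-refl (proj₁ (∈-full⁻ m)) })
              (pairsWith-unique (λ v → Unique.filter⁺ (adjacent? i j G v) (ancestors-unique v))
                  vertices-unique)))
          (All.tabulate λ { {u , v} m → let (e , e∈ , J) = adjacent-edge (proj₂ (∈-full⁻ m)) in lose (∈-elements⁺ e∈) J })

        -- Normality enters here: the ends of an edge are comparable, so one of its two directions
        -- occurs in `full`.
        full≥ : length (elements G) ≤ length full
        full≥ = length-injection (λ e p → Joins p e)
          (AllPairs.map (λ ne p J J′ → ne (joins-functional J J′)) (elements-unique G))
          (All.tabulate λ {e} m → hit e (∈-elements⁻ m))
          where
          hit : ∀ e → e ∈ˢ G → Any (λ p → Joins p e) full
          hit e e∈ with x , y , refl ← Fin.combine-surjective {i} {j} e with comparable (l—r e∈)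
          ... | inj₁ m = lose (∈-full m (r—l e∈)) (x , y , refl , inj₂ refl)
          ... | inj₂ m = lose (∈-full m (l—r e∈)) (x , y , refl , inj₁ refl)

        first-adjacent : ∀ {v u a} → ancestors v ≡ u ∷ a → Adjacent i j G v u
        first-adjacent {v} e with parent v
        ... | inj₁ refl with () ← trans (sym root-ancestors) e
        ... | inj₂ (p , c) with refl , _ ← ∷-injective (trans (sym c) e) = child-adjacent c

        -- The parent always passes the filter, because tree edges are edges of `G`.
        length-full-split : ∀ v → length (filter (adjacent? i j G v) (ancestors v)) ≡
          length (take 1 (ancestors v)) + length (filter (adjacent? i j G v) (drop 1 (ancestors v)))
        length-full-split v = go (ancestors v) first-adjacent
          where
          go : ∀ a → (∀ {u b} → a ≡ u ∷ b → Adjacent i j G v u) →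
              length (filter (adjacent? i j G v) a) ≡
            length (take 1 a) + length (filter (adjacent? i j G v) (drop 1 a))
          go []      _   = refl
          go (u ∷ a) adj = cong length (filter-accept (adjacent? i j G v) (adj refl))

        length-parentPairs : suc (length parentPairs) ≡ i + j
        length-parentPairs = trans (cong suc (length-pairsWith _ allVertices))
          (trans (with-root (subst (_∈ allVertices) (sym root≡) (∈-allVertices _))
              vertices-unique) length-vertices)
          where
          non-root : ∀ {vs} → All (root ≢_) vs →
              ∑ vs (λ v → length (take 1 (ancestors v))) ≡ length vs
          non-root [] = refl
          non-root {v ∷ vs} (ne ∷ nes) with parent v
          ... | inj₁ e       = ⊥-elim (ne (sym e))
          ... | inj₂ (p , c) = cong₂ _+_ (cong (λ a → length (take 1 a)) c) (non-root nes)
          with-root : ∀ {vs} → root ∈ vs → Unique vs →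
              suc (∑ vs (λ v → length (take 1 (ancestors v)))) ≡ length vs
          with-root (here refl) (ne ∷ _) = cong suc
              (cong₂ _+_ (cong (λ a → length (take 1 a)) root-ancestors) (non-root ne))
          with-root {v ∷ vs} (there m) (ne ∷ u) with parent v
          ... | inj₁ refl    = ⊥-elim (All.lookup ne m refl)
          ... | inj₂ (p , c) = cong suc (trans (cong₂ _+_ (cong (λ a → length (take 1 a)) c) refl)
              (with-root m u))

        length-full : length full ≡ length parentPairs + length excess
        length-full = begin
          length full
            ≡⟨ length-pairsWith _ allVertices ⟩
          ∑ allVertices (λ v → length (filter (adjacent? i j G v) (ancestors v)))
            ≡⟨ ∑-cong allVertices length-full-split ⟩
          ∑ allVertices (λ v → length (take 1 (ancestors v)) + length
              (filter (adjacent? i j G v) (drop 1 (ancestors v))))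
            ≡⟨ ∑-+ allVertices _ _ ⟩
          ∑ allVertices (λ v → length (take 1 (ancestors v))) + ∑ allVertices (λ v →
              length (filter (adjacent? i j G v) (drop 1 (ancestors v))))
            ≡⟨ cong₂ _+_ (length-pairsWith _ allVertices) (length-pairsWith _ allVertices) ⟨
          length parentPairs + length excess ∎
          where open ≡-Reasoning

      length-excess : suc ∣ G ∣ ≡ i + j + length excess
      length-excess = begin
        suc ∣ G ∣                                  ≡⟨ cong suc (length-elements G) ⟨
        suc (length (elements G))                  ≡⟨ cong suc (≤-antisym full≥ full≤) ⟩
        suc (length full)                          ≡⟨ cong suc length-full ⟩
        suc (length parentPairs) + length excess   ≡⟨ cong (_+ length excess) length-parentPairs ⟩
        i + j + length excess                      ∎
        where open ≡-Reasoning

      decodes : Decodes G r excess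
      decodes = trans (cong ancestors (sym root≡)) root-ancestors ,
        (λ x y → [ (λ m → edge (linked m)) , (λ m → edge (adjacent-sym (linked m))) ]′) ,
        (λ x y m → [ (λ y<x → inj₂ (link y<x (r—l m))) , (λ x<y →
            inj₁ (link x<y (l—r m))) ]′ (comparable (l—r m)))
        where
        edge : ∀ {x y} → Adjacent i j G (inj₁ x) (inj₂ y) → combine x y ∈ˢ G
        edge (l—r m) = m
        first : ∀ {v u} a → ancestors v ≡ a → u ∈ take 1 a → Adjacent i j G v u
        first (u ∷ a) e (here refl) = first-adjacent e
        linked : ∀ {u v} → (u , v) ∈ parentPairs ++ excess → Adjacent i j G u v
        linked {u} {v} m with ∈-++⁻ parentPairs m
        ... | inj₁ m′ = first _ refl (∈-pairsWith⁻ (λ v → take 1 (ancestors v)) allVertices m′)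
        ... | inj₂ m′ = proj₂ (∈-filter⁻ (adjacent? i j G u) {v} {drop 1 (ancestors u)}
                          (∈-pairsWith⁻ (λ v → filter (adjacent? i j G v) (drop 1 (ancestors v)))
                              allVertices m′))
        link : ∀ {u v} → v ∈ ancestors u → Adjacent i j G u v → (u , v) ∈ parentPairs ++ excess
        link {u} {v} v∈ a = cases (ancestors u) refl v∈
          where
          cases : ∀ b → ancestors u ≡ b → v ∈ b → (u , v) ∈ parentPairs ++ excess
          cases (w ∷ b) e (here refl) = ∈-++⁺ˡ
              (∈-pairsWith⁺ (∈-allVertices u) (subst (λ c → v ∈ take 1 c) (sym e) (here refl)))
          cases (w ∷ b) e (there m)   = ∈-++⁺ʳ parentPairs (∈-pairsWith⁺ (∈-allVertices u)
            (∈-filter⁺ (adjacent? i j G u) (subst (λ c → v ∈ drop 1 c) (sym e) m) a))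

-- Normal trees of connected graphs, and the resulting count

module _ (i j : ℕ) where

  adjacent-sym : ∀ {G u v} → Adjacent i j G u v → Adjacent i j G v u
  adjacent-sym (l—r m) = r—l m
  adjacent-sym (r—l m) = l—r m

  record NormalTree (G : BipartiteGraph i j) (r : Fin i) (T : BTree i j) : Set where
    open Tree T
    field
      root≡          : root ≡ inj₁ r
      child-adjacent : ∀ {v p} → Child v p → Adjacent i j G v p
      comparable     : ∀ {u v} → Adjacent i j G u v → u ∈ ancestors v ⊎ v ∈ ancestors u

  normalTree : ∀ G → Connected i j G → ∀ r → ∃[ T ] NormalTree G r T
  normalTree G connected r = T , record
    { root≡ = refl ; child-adjacent = child-adjacent ; comparable = ancestors-comparable }
    where
    open DepthFirstSearch (_≟ᵥ_ i j) (adjacent? i j G) adjacent-sym (λ ()) (inj₁ r)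
      (connected (inj₁ r)) (allVertices i j) (∈-allVertices i j)
    left : ∀ {v} → v ∈ lefts i j → v ≡ inj₁ r ⊎
        (∃[ p ] ancestors v ≡ p ∷ ancestors p × p ∈ rights i j)
    left m with x , _ , refl ← ∈-map⁻ inj₁ m with ancestors-child (inj₁ x)
    ... | inj₁ e                         = inj₁ e
    ... | inj₂ (_ , c , l—r {y = y} _) = inj₂ (inj₂ y , c , ∈-rights i j y)
    right : ∀ {v} → v ∈ rights i j → ∃[ p ] ancestors v ≡ p ∷ ancestors p × p ∈ lefts i j
    right m with y , _ , refl ← ∈-map⁻ inj₂ m with ancestors-child (inj₂ y)
    ... | inj₂ (_ , c , r—l {x = x} _) = inj₁ x , c , ∈-lefts i j x
    T : BTree i j
    T = record { ancestors = ancestors ; root = inj₁ r ; root-ancestors = ancestors-root ; left =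
        left ; right = right }
    child-adjacent : ∀ {v p} → ancestors v ≡ p ∷ ancestors p → Adjacent i j G v p
    child-adjacent {v} c with ancestors-child v
    ... | inj₁ refl with () ← trans (sym ancestors-root) c
    ... | inj₂ (q , e , a) with refl , _ ← ∷-injective (trans (sym e) c) = a

  private
    vertex-side : ∀ v → Vertices {Ls = lefts i j} {Rs = rights i j} v
    vertex-side (inj₁ x) = inj₁ (∈-lefts i j x)
    vertex-side (inj₂ y) = inj₂ (∈-rights i j y)

  -- A representative replaces the tree that the search returned and has to serve the same graph;
  -- for this, `T ≈ T′` suffices because every vertex lies on one of the two sides.
  normal-≈ : ∀ {G r T T′} → T ≈ T′ → NormalTree G r T → NormalTree G r T′
  normal-≈ {G} {r} {T} {T′} T≈T′ normal = record
    { root≡ = sym (decodes-root i j T′ (trans (sym (eq (inj₁ r)))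
        (trans (cong ancestors (sym root≡)) root-ancestors)))
    ; child-adjacent = λ {v} {p} c → child-adjacent
        (trans (eq v) (trans c (cong (p ∷_) (sym (eq p)))))
    ; comparable = λ {u} {v} a → Sum.map (subst (u ∈_) (eq v)) (subst (v ∈_) (eq u))
        (comparable a) }
    where
    open NormalTree normal
    open Tree T
    eq : ∀ v → ancestors v ≡ Tree.ancestors T′ v
    eq v = T≈T′ (vertex-side v)

  _≈?_ : ∀ (T T′ : BTree i j) → Dec (T ≈ T′)
  T ≈? T′ = map′ (λ h {v} _ → All.lookup h (∈-allVertices i j v)) (λ h → All.tabulate λ {v} _ →
      h (vertex-side v))
    (All.all? (λ v → List.≡-dec (_≟ᵥ_ i j) (Tree.ancestors T v) (Tree.ancestors T′ v))
        (allVertices i j))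

  private
    treesOf : ∀ G → Dec (Connected i j G) → List (BTree i j)
    treesOf G (yes c) = map (λ r → proj₁ (normalTree G c r)) (allFin i)
    treesOf G (no _)  = []

    -- No enumeration of all trees is made: the moment bounds hold for every list of pairwise
    -- inequivalent trees, so those found by the search are enough.
    someTrees : List (BTree i j)
    someTrees = concatMap (λ G → treesOf G (connected? i j G)) (subsets (i * j))

    trees-representatives = representatives _≈?_ (λ _ → refl) someTrees

    trees : List (BTree i j)
    trees = proj₁ trees-representatives

    treesOf-normal : ∀ G (d : Dec (Connected i j G)) → Connected i j G → ∀ r →
        ∃[ T ] T ∈ treesOf G d × NormalTree G r T
    treesOf-normal G (yes c) _ r = _ , ∈-map⁺ _ (∈-allFin r) , proj₂ (normalTree G c r)
    treesOf-normal G (no ¬c) c r = ⊥-elim (¬c c)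

    trees-normal : ∀ {G} → G ∈ subsets (i * j) → Connected i j G → ∀ r →
        ∃[ T ] T ∈ trees × NormalTree G r T
    trees-normal {G} G∈ c r =
      let (T , T∈ , normal) = treesOf-normal G (connected? i j G) c r
          (T′ , T′∈ , T≈T′) = find (All.lookup (proj₂ (proj₂ trees-representatives))
              (∈-concatMap⁺ _ (lose G∈ T∈)))
      in T′ , T′∈ , normal-≈ T≈T′ normal

  module _ (ℓ : ℕ) where

    private
      k = suc ℓ
      graphs : List (BipartiteGraph i j)
      graphs = filter (counted? i j (+ ℓ)) (subsets (i * j))

      codes : List (BTree i j × List (Vertex i j × Vertex i j))
      codes = pairsWith (λ T → sublists k (candidates i j T)) trees

      rooted≤codes : length (cartesianProduct graphs (allFin i)) ≤ length codes
      rooted≤codes = length-injection (λ (G , r) (T , S) → Decodes i j T G r S)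
        (AllPairs.map (λ ne (T , S) d d′ → ne (decodes-functional i j T d d′))
          (Unique.cartesianProduct⁺ (Unique.filter⁺ (counted? i j (+ ℓ)) (subsets-unique (i * j)))
              (Unique.allFin⁺ i)))
        (All.tabulate λ { {G , r} m → hit G r (proj₁ (∈-cartesianProduct⁻ graphs (allFin i) m)) })
        where
        hit : ∀ G r → G ∈ graphs → Any (λ (T , S) → Decodes i j T G r S) codes
        hit G r m with ∈-filter⁻ (counted? i j (+ ℓ)) {G} {subsets (i * j)} m
        ... | G∈ , connected , size with trees-normal G∈ connected r
        ...   | T , T∈ , normal = lose (∈-pairsWith⁺ T∈ excess∈) decodes
          where
          open NormalTree normal
          open Normal i j T G child-adjacent comparable r root≡
          length-excess≡ : length excess ≡ k
          length-excess≡ = +-cancelˡ-≡ (i + j) _ _ (trans (sym length-excess)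
            (trans (cong suc (ℤ.+-injective size)) (sym (+-suc (i + j) ℓ))))
          excess∈ : excess ∈ sublists k (candidates i j T)
          excess∈ = subst (λ l → excess ∈ sublists l (candidates i j T)) length-excess≡
              (sublists-complete excess-⊆)

      A = pathSum i j (_^ k) (pred i) j 0
      B = pathSum i j (_^ k) (pred i) (pred j) 1

      ∑-depth : ∑ trees (λ T → ∑ (allVertices i j) (Tree.depth T) ^ k) ≤ (i + j) ^ ℓ
          * (i * (2 ^ k * A) + j * (2 ^ k * (i * B)))
      ∑-depth = begin
        ∑ trees (λ T → ∑ (allVertices i j) (Tree.depth T) ^ k)
          ≤⟨ ∑-mono′ trees (λ T → powerMean (Tree.depth T) ℓ (allVertices i j)) ⟩
        ∑ trees (λ T → length (allVertices i j) ^ ℓ * ∑ (allVertices i j) (λ v →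
            Tree.depth T v ^ k))
          ≡⟨ trans (∑-*ˡ (length (allVertices i j) ^ ℓ) trees _)
              (cong₂ (λ l s → l ^ ℓ * s) (length-vertices i j) (∑-swap trees (allVertices i j) _)) ⟩
        (i + j) ^ ℓ * ∑ (allVertices i j) (λ v → ∑ trees (λ T → Tree.depth T v ^ k))
          ≡⟨ cong ((i + j) ^ ℓ *_) (∑-++ (lefts i j) (rights i j) _) ⟩
        (i + j) ^ ℓ * (∑ (lefts i j) (λ v → ∑ trees (λ T → Tree.depth T v ^ k)) + ∑ (rights i j)
            (λ v → ∑ trees (λ T → Tree.depth T v ^ k)))
          ≤⟨ *-monoʳ-≤ ((i + j) ^ ℓ) (+-mono-≤
               (side (lefts i j) (length-lefts i j) λ m → ≤-trans
                 (∑-depth-left (lefts-unique i j) (rights-unique i j) k separated m)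
                 (≤-reflexive (cong₂ (λ a b → 2 ^ k * pathSum a b (_^ k) (pred a) b 0)
                     (length-lefts i j) (length-rights i j))))
               (side (rights i j) (length-rights i j) λ m → ≤-trans
                 (∑-depth-right (lefts-unique i j) (rights-unique i j) k separated m)
                 (≤-reflexive (cong₂ (λ a b → 2 ^ k
                     * (a * pathSum a b (_^ k) (pred a) (pred b) 1)) (length-lefts i j)
                     (length-rights i j))))) ⟩
        (i + j) ^ ℓ * (i * (2 ^ k * A) + j * (2 ^ k * (i * B))) ∎
        where
        open ≤-Reasoning
        separated = proj₁ (proj₂ trees-representatives)
        side : ∀ vs {l} → length vs ≡ l → ∀ {f : Vertex i j → ℕ} {b} →
            (∀ {v} → v ∈ vs → f v ≤ b) → ∑ vs f ≤ l * b
        side vs refl {b = b} h = ≤-trans (∑-mono (All.tabulate h)) (≤-reflexive (∑-const vs b))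

    C-bound : i * (k ! * C i j (+ ℓ)) ≤ (i + j) ^ ℓ * (i * (2 ^ k * A) + j * (2 ^ k * (i * B)))
    C-bound = begin
      i * (k ! * C i j (+ ℓ))
        ≡⟨ eq i (k !) (length graphs) ⟩
      k ! * (length graphs * i)
        ≡⟨ cong (k ! *_) (trans (cong (length graphs *_) (sym (length-allFin i j i)))
            (sym (length-product graphs))) ⟩
      k ! * length (cartesianProduct graphs (allFin i))
        ≤⟨ *-monoʳ-≤ (k !) rooted≤codes ⟩
      k ! * length codes
        ≡⟨ trans (cong (k ! *_) (length-pairsWith _ trees)) (sym (∑-*ˡ (k !) trees _)) ⟩
      ∑ trees (λ T → k ! * length (sublists k (candidates i j T)))
        ≤⟨ ∑-mono′ trees (λ T → ≤-trans (length-sublists k (candidates i j T))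
            (^-monoˡ-≤ k (length-candidates i j T))) ⟩
      ∑ trees (λ T → ∑ (allVertices i j) (Tree.depth T) ^ k)
        ≤⟨ ∑-depth ⟩
      (i + j) ^ ℓ * (i * (2 ^ k * A) + j * (2 ^ k * (i * B))) ∎
      where
      open ≤-Reasoning
      eq : ∀ a b c → a * (b * c) ≡ b * (c * a)
      eq = solve-∀
      length-product : ∀ {X Y : Set} (xs : List X) {ys : List Y} →
          length (cartesianProduct xs ys) ≡ length xs * length ys
      length-product []            = refl
      length-product (x ∷ xs) {ys} = trans (length-++ (map (x ,_) ys))
          (cong₂ _+_ (length-map (x ,_) ys) (length-product xs))

-- The bound in natural numbers

-- A step multiplies the left side by (2ℓ+2)(2ℓ+1) and the right side by (2ℓ+2)².
!-doubled : ∀ ℓ → (ℓ + ℓ) ! ≤ 4 ^ ℓ * (ℓ ! * ℓ !)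
!-doubled zero    = ≤-refl
!-doubled (suc ℓ) = begin
  (suc ℓ + suc ℓ) !                                  ≡⟨ cong (λ m → suc m !) (+-suc ℓ ℓ) ⟩
  suc (suc (ℓ + ℓ)) * (suc (ℓ + ℓ) * (ℓ + ℓ) !)
      ≤⟨ *-monoʳ-≤ (suc (suc (ℓ + ℓ))) (*-mono-≤ (n≤1+n (suc (ℓ + ℓ))) (!-doubled ℓ)) ⟩
  suc (suc (ℓ + ℓ)) * (suc (suc (ℓ + ℓ)) * (4 ^ ℓ * (ℓ ! * ℓ !))) ≡⟨ eq ℓ (4 ^ ℓ) (ℓ !) ⟩
  4 * 4 ^ ℓ * (suc ℓ * ℓ ! * (suc ℓ * ℓ !))          ∎
  where
  open ≤-Reasoning
  eq : ∀ ℓ p f → suc (suc (ℓ + ℓ)) * (suc (suc (ℓ + ℓ)) * (p * (f * f))) ≡ 4 * p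
      * (suc ℓ * f * (suc ℓ * f))
  eq = solve-∀

!-shifted : ∀ ℓ t → ℓ ^ t * ℓ ! ≤ (t + ℓ) !
!-shifted ℓ zero    = ≤-reflexive (*-identityˡ (ℓ !))
!-shifted ℓ (suc t) = ≤-trans (≤-reflexive (*-assoc ℓ (ℓ ^ t) (ℓ !)))
  (*-mono-≤ (≤-trans (m≤n+m ℓ t) (n≤1+n (t + ℓ))) (!-shifted ℓ t))

-- The central binomial coefficient lies between n^n / n! and 4^n.
n^n≤4^n*n! : ∀ n → n ^ n ≤ 4 ^ n * n !
n^n≤4^n*n! n = *-cancelʳ-≤ (n ^ n) (4 ^ n * n !) (n !) {{n !≢0}}
  (≤-trans (!-shifted n n) (≤-trans (!-doubled n)
      (≤-reflexive (sym (*-assoc (4 ^ n) (n !) (n !))))))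

square-mono : ∀ {a b} → a ≤ b → a * a ≤ b * b
square-mono a≤b = *-mono-≤ a≤b a≤b

square-sum : ∀ a b → (a + b) * (a + b) ≤ 2 * (a * a + b * b)
square-sum a b = begin
  (a + b) * (a + b)                     ≡⟨ eq₁ a b ⟩
  2 * (a * b) + (a * a + b * b)         ≤⟨ +-monoˡ-≤ (a * a + b * b) (2xy≤x²+y² a b) ⟩
  a * a + b * b + (a * a + b * b)       ≡⟨ eq₂ (a * a + b * b) ⟩
  2 * (a * a + b * b)                   ∎
  where
  open ≤-Reasoning
  eq₁ : ∀ a b → (a + b) * (a + b) ≡ 2 * (a * b) + (a * a + b * b)
  eq₁ = solve-∀
  eq₂ : ∀ a → a + a ≡ 2 * a
  eq₂ = solve-∀

-- This is 720 · 4 · 8. The 4 comes from `n^n≤4^n*n!`. The 8 is the square of the 2 in depth ≤ 2s,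
-- times the 2 in the moment factor 2i. Since 8 is raised to ℓ + 1, one more 8 is left over, and 720
-- = 8 · 9 · 10 with 9 from the square of i + j ≤ 3i and 10 = 2 · (4 + 1) from `sum-square`.
constant : ℕ
constant = 23040

-- The theorem squared and cleared of denominators, which turns the half-integral powers into
-- natural numbers.
C-square-bound : ∀ i j ℓ .{{_ : NonZero i}} .{{_ : NonZero j}} .{{_ : NonZero ℓ}} → i ≤ 2 * j →
    j ≤ 2 * i →
  C i j (+ ℓ) * C i j (+ ℓ) * ℓ ^ ℓ ≤
  constant ^ ℓ * ((i + j) ^ (3 * ℓ ∸ 1) * (functions i j i j * functions i j i j))
C-square-bound i@(suc i′) j@(suc j′) ℓ@(suc m) i≤2j j≤2i = begin
  c * c * ℓ ^ ℓ
    -- `ℓ ^ ℓ` is absorbed by the one `k !` that `scaled` keeps on its left side.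
    ≤⟨ *-monoʳ-≤ (c * c) (≤-trans (n^n≤4^n*n! ℓ) (*-monoʳ-≤ (4 ^ ℓ) (m≤n*m (ℓ !) k))) ⟩
  c * c * (4 ^ ℓ * k !)
    ≡⟨ eq₁ c (4 ^ ℓ) (k !) ⟩
  4 ^ ℓ * (k ! * (c * c))
    ≤⟨ *-monoʳ-≤ (4 ^ ℓ) scaled ⟩
  4 ^ ℓ * (90 * 8 ^ k * (N * ψψ))
    ≡⟨ eq₂ (4 ^ ℓ) (8 ^ ℓ) (N * ψψ) ⟩
  720 * (4 ^ ℓ * 8 ^ ℓ) * (N * ψψ)
    -- As ℓ is positive, a constant factor can be moved under the exponent.
    ≤⟨ *-monoˡ-≤ (N * ψψ) (*-monoˡ-≤ (4 ^ ℓ * 8 ^ ℓ) (m≤m^n 720 ℓ)) ⟩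
  720 ^ ℓ * (4 ^ ℓ * 8 ^ ℓ) * (N * ψψ)
    ≡⟨ cong (_* (N * ψψ)) (trans (cong (720 ^ ℓ *_) (sym (^-distribʳ-* ℓ 4 8)))
        (sym (^-distribʳ-* ℓ 720 32))) ⟩
  constant ^ ℓ * (N * ψψ) ∎
  where
  open ≤-Reasoning
  k = suc ℓ
  n = i + j
  c = C i j (+ ℓ)
  ψ = functions i j i j
  ψψ = ψ * ψ
  N = n ^ (3 * ℓ ∸ 1)
  A = pathSum i j (_^ k) i′ j 0
  B = pathSum i j (_^ k) i′ j′ 1
  D = pathSum i j (_^ k) i j 0

  eq₁ : ∀ c p f → c * c * (p * f) ≡ p * (f * (c * c))
  eq₁ = solve-∀
  eq₂ : ∀ p e z → p * (90 * (8 * e) * z) ≡ 720 * (p * e) * z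
  eq₂ = solve-∀

  m≤m^n : ∀ m n .{{_ : NonZero m}} .{{_ : NonZero n}} → m ≤ m ^ n
  m≤m^n m (suc n) = ≤-trans (≤-reflexive (sym (*-identityʳ m))) (*-monoʳ-≤ m (m^n>0 m n))

  -- The contribution `i * j * B` of the right vertices is `D` without its first term. `B` starts
  -- with s = 1, whereas `D` starts with s = 0, where the moment bounds are available.
  linear : i * (k ! * c) ≤ n ^ ℓ * 2 ^ k * (i * A + D)
  linear = begin
    i * (k ! * c)                                              ≤⟨ C-bound i j ℓ ⟩
    n ^ ℓ * (i * (2 ^ k * A) + j * (2 ^ k * (i * B)))          ≡⟨ eq (n ^ ℓ) i j (2 ^ k) A B ⟩
    n ^ ℓ * 2 ^ k * (i * A + i * j * B)
        ≤⟨ *-monoʳ-≤ (n ^ ℓ * 2 ^ k) (+-monoʳ-≤ (i * A)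
        (m≤n+m (i * j * B) (forests i j i j * 0 ^ k))) ⟩
    n ^ ℓ * 2 ^ k * (i * A + D)                                ∎
    where
    eq : ∀ l i j p a b → l * (i * (p * a) + j * (p * (i * b))) ≡ l * p * (i * a + i * j * b)
    eq = solve-∀

  -- `functions i j i′ j` lacks one factor j of ψ; the factor i supplies it up to 2, and squaring
  -- gives the 4.
  A-square : i * A * (i * A) ≤ k ! * (2 * i) ^ k * (4 * ψψ)
  A-square = begin
    i * A * (i * A)
      ≡⟨ eq i A ⟩
    i * i * (A * A)
      ≤⟨ *-monoʳ-≤ (i * i) (pathSum-square i j k i′ j (n≤1+n i′) ≤-refl) ⟩
    i * i * (F * (ψ′ * ψ′))
      ≡⟨ eq′ i F ψ′ ⟩
    F * ((i * ψ′) * (i * ψ′))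
      ≤⟨ *-monoʳ-≤ F (square-mono (*-monoˡ-≤ ψ′ i≤2j)) ⟩
    F * ((2 * j * ψ′) * (2 * j * ψ′))
      ≡⟨ cong (F *_) (eq″ j (j ^ i′) (i ^ j)) ⟩
    F * (4 * ψψ) ∎
    where
    F = k ! * (2 * i) ^ k
    ψ′ = functions i j i′ j
    eq : ∀ i a → i * a * (i * a) ≡ i * i * (a * a)
    eq = solve-∀
    eq′ : ∀ i f p → i * i * (f * (p * p)) ≡ f * ((i * p) * (i * p))
    eq′ = solve-∀
    eq″ : ∀ j p q → 2 * j * (p * q) * (2 * j * (p * q)) ≡ 4 * (j * p * q * (j * p * q))
    eq″ = solve-∀

  sum-square : (i * A + D) * (i * A + D) ≤ k ! * (2 * i) ^ k * (10 * ψψ)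
  sum-square = begin
    (i * A + D) * (i * A + D)
      ≤⟨ square-sum (i * A) D ⟩
    2 * (i * A * (i * A) + D * D)
      ≤⟨ *-monoʳ-≤ 2 (+-mono-≤ A-square (pathSum-square i j k i j ≤-refl ≤-refl)) ⟩
    2 * (k ! * (2 * i) ^ k * (4 * ψψ) + k ! * (2 * i) ^ k * ψψ)
      ≡⟨ eq (k ! * (2 * i) ^ k) ψψ ⟩
    k ! * (2 * i) ^ k * (10 * ψψ) ∎
    where
    eq : ∀ f z → 2 * (f * (4 * z) + f * z) ≡ f * (10 * z)
    eq = solve-∀

  quadratic : i * i * (k ! * (c * c)) ≤ 10 * 8 ^ k * (n ^ ℓ * n ^ ℓ * n ^ k * ψψ)
  quadratic = *-cancelˡ-≤ (k !) {{k !≢0}} (begin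
    k ! * (i * i * (k ! * (c * c)))
      ≡⟨ eq (k !) i c ⟩
    i * (k ! * c) * (i * (k ! * c))
      ≤⟨ square-mono linear ⟩
    n ^ ℓ * 2 ^ k * (i * A + D) * (n ^ ℓ * 2 ^ k * (i * A + D))
      ≡⟨ eq′ (n ^ ℓ) (2 ^ k) (i * A + D) ⟩
    n ^ ℓ * n ^ ℓ * (2 ^ k * 2 ^ k) * ((i * A + D) * (i * A + D))
      ≤⟨ *-monoʳ-≤ (n ^ ℓ * n ^ ℓ * (2 ^ k * 2 ^ k)) sum-square ⟩
    n ^ ℓ * n ^ ℓ * (2 ^ k * 2 ^ k) * (k ! * (2 * i) ^ k * (10 * ψψ))
      ≤⟨ *-monoʳ-≤ (n ^ ℓ * n ^ ℓ * (2 ^ k * 2 ^ k))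
          (*-monoˡ-≤ (10 * ψψ) (*-monoʳ-≤ (k !) (^-monoˡ-≤ k (*-monoʳ-≤ 2 (m≤m+n i j))))) ⟩
    n ^ ℓ * n ^ ℓ * (2 ^ k * 2 ^ k) * (k ! * (2 * n) ^ k * (10 * ψψ))
      ≡⟨ cong₂ (λ a b → n ^ ℓ * n ^ ℓ * a * (k ! * b * (10 * ψψ))) (sym (^-distribʳ-* k 2 2))
          (^-distribʳ-* k 2 n) ⟩
    n ^ ℓ * n ^ ℓ * 4 ^ k * (k ! * (2 ^ k * n ^ k) * (10 * ψψ))
      ≡⟨ eq″ (n ^ ℓ) (4 ^ k) (k !) (2 ^ k) (n ^ k) ψψ ⟩
    k ! * (10 * (4 ^ k * 2 ^ k) * (n ^ ℓ * n ^ ℓ * n ^ k * ψψ))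
      ≡⟨ cong (λ a → k ! * (10 * a * (n ^ ℓ * n ^ ℓ * n ^ k * ψψ))) (sym (^-distribʳ-* k 4 2)) ⟩
    k ! * (10 * 8 ^ k * (n ^ ℓ * n ^ ℓ * n ^ k * ψψ)) ∎)
    where
    eq : ∀ f i c → f * (i * i * (f * (c * c))) ≡ i * (f * c) * (i * (f * c))
    eq = solve-∀
    eq′ : ∀ a b z → a * b * z * (a * b * z) ≡ a * a * (b * b) * (z * z)
    eq′ = solve-∀
    eq″ : ∀ a q f t b z → a * a * q * (f * (t * b) * (10 * z)) ≡ f
        * (10 * (q * t) * (a * a * b * z))
    eq″ = solve-∀

  n≤3i : n ≤ 3 * i
  n≤3i = ≤-trans (+-monoʳ-≤ i j≤2i) (≤-reflexive (eq i))
    where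
    eq : ∀ i → i + 2 * i ≡ 3 * i
    eq = solve-∀

  -- The exponents satisfy 2ℓ + (ℓ + 1) = 2 + (3ℓ - 1). The two separated factors n cancel in
  -- `scaled` against i², by `n≤3i`.
  powers : n ^ ℓ * n ^ ℓ * n ^ k ≡ n * n * N
  powers = trans (cong (_* n ^ k) (sym (^-distribˡ-+-* n ℓ ℓ)))
    (trans (sym (^-distribˡ-+-* n (ℓ + ℓ) k)) (trans (cong (n ^_) (exponent m))
        (sym (*-assoc n n N))))
    where
    exponent : ∀ m → suc m + suc m + suc (suc m) ≡ suc (suc (m + (suc m + (suc m + 0))))
    exponent = solve-∀

  scaled : k ! * (c * c) ≤ 90 * 8 ^ k * (N * ψψ)
  scaled = *-cancelˡ-≤ (n * n) (begin
    n * n * (k ! * (c * c))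
      ≤⟨ *-monoˡ-≤ (k ! * (c * c)) (square-mono n≤3i) ⟩
    3 * i * (3 * i) * (k ! * (c * c))
      ≡⟨ eq i (k ! * (c * c)) ⟩
    9 * (i * i * (k ! * (c * c)))
      ≤⟨ *-monoʳ-≤ 9 quadratic ⟩
    9 * (10 * 8 ^ k * (n ^ ℓ * n ^ ℓ * n ^ k * ψψ))
      ≡⟨ cong (λ p → 9 * (10 * 8 ^ k * (p * ψψ))) powers ⟩
    9 * (10 * 8 ^ k * (n * n * N * ψψ))
      ≡⟨ eq′ (8 ^ k) n N ψψ ⟩
    n * n * (90 * 8 ^ k * (N * ψψ)) ∎)
    where
    eq : ∀ i z → 3 * i * (3 * i) * z ≡ 9 * (i * i * z)
    eq = solve-∀
    eq′ : ∀ e n N z → 9 * (10 * e * (n * n * N * z)) ≡ n * n * (90 * e * (N * z))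
    eq′ = solve-∀

-- The bound in cuts

-- ι n is definitionally fromℚᵘ (mkℚᵘ (+ n) 0).
ι : ℕ → ℚ
ι n = + n ℚ./ 1

fromℚᵘ-homo-* : ∀ p q → fromℚᵘ p ℚ.* fromℚᵘ q ≡ fromℚᵘ (p ℚᵘ.* q)
fromℚᵘ-homo-* p q = ℚ.toℚᵘ-injective (ℚᵘ.≃-trans (ℚ.toℚᵘ-homo-* (fromℚᵘ p) (fromℚᵘ q))
  (ℚᵘ.≃-trans (ℚᵘ.*-cong (ℚ.toℚᵘ-fromℚᵘ p) (ℚ.toℚᵘ-fromℚᵘ q))
      (ℚᵘ.≃-sym (ℚ.toℚᵘ-fromℚᵘ (p ℚᵘ.* q)))))

fromℚᵘ-mono-≤ : ∀ {p q} → p ℚᵘ.≤ q → fromℚᵘ p ℚ.≤ fromℚᵘ q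
fromℚᵘ-mono-≤ {p} {q} p≤q = ℚ.toℚᵘ-cancel-≤ (ℚᵘ.≤-respˡ-≃ (ℚᵘ.≃-sym (ℚ.toℚᵘ-fromℚᵘ p))
  (ℚᵘ.≤-respʳ-≃ (ℚᵘ.≃-sym (ℚ.toℚᵘ-fromℚᵘ q)) p≤q))

fromℚᵘ-cancel-≤ : ∀ {p q} → fromℚᵘ p ℚ.≤ fromℚᵘ q → p ℚᵘ.≤ q
fromℚᵘ-cancel-≤ {p} {q} p≤q = ℚᵘ.≤-respˡ-≃ (ℚ.toℚᵘ-fromℚᵘ p)
    (ℚᵘ.≤-respʳ-≃ (ℚ.toℚᵘ-fromℚᵘ q) (ℚ.toℚᵘ-mono-≤ p≤q))

ι-* : ∀ m n → ι (m ℕ.* n) ≡ ι m ℚ.* ι n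
ι-* m n = trans (cong (ℚ._/ 1) (ℤ.pos-* m n)) (sym (fromℚᵘ-homo-* (mkℚᵘ (+ m) 0) (mkℚᵘ (+ n) 0)))

ι-^ : ∀ m n → ι (m ℕ.^ n) ≡ ι m ^ℚ n
ι-^ m zero    = refl
ι-^ m (suc n) = trans (ι-* m (m ℕ.^ n)) (cong (ι m ℚ.*_) (ι-^ m n))

ι-mono-≤ : ∀ {m n} → m ℕ.≤ n → ι m ℚ.≤ ι n
ι-mono-≤ {m} {n} m≤n = fromℚᵘ-mono-≤ {mkℚᵘ (+ m) 0} {mkℚᵘ (+ n) 0}
    (*≤* (ℤ.*-monoʳ-≤-nonNeg (+ 1) (ℤ.+≤+ m≤n)))

ι-pos : ∀ n .{{_ : NonZero n}} → 0ℚ ℚ.< ι n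
ι-pos (suc n) = ℚ.positive⁻¹ (ι (suc n)) {{ℚ.normalize-pos (suc n) 1}}

*-pos : ∀ {p q} → 0ℚ ℚ.< p → 0ℚ ℚ.< q → 0ℚ ℚ.< p ℚ.* q
*-pos {p} {q} 0<p 0<q = subst (ℚ._< p ℚ.* q) (ℚ.*-zeroˡ q) (ℚ.*-monoˡ-<-pos q {{positive 0<q}} 0<p)

^ℚ-pos : ∀ {p} n → 0ℚ ℚ.< p → 0ℚ ℚ.< p ^ℚ n
^ℚ-pos zero    _   = ℚ.positive⁻¹ 1ℚ
^ℚ-pos (suc n) 0<p = *-pos 0<p (^ℚ-pos n 0<p)

*-mono-<′ : ∀ {p q r s} → 0ℚ ℚ.< p → 0ℚ ℚ.< r → p ℚ.< q → r ℚ.< s → p ℚ.* r ℚ.< q ℚ.* s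
*-mono-<′ {p} {q} {r} {s} 0<p 0<r p<q r<s = ℚ.<-trans
  (ℚ.*-monoˡ-<-pos r {{positive 0<r}} p<q)
  (ℚ.*-monoʳ-<-pos q {{positive (ℚ.<-trans 0<p p<q)}} r<s)

*-monoˡ-≤′ : ∀ {p q} r → 0ℚ ℚ.< r → p ℚ.≤ q → p ℚ.* r ℚ.≤ q ℚ.* r
*-monoˡ-≤′ r 0<r = ℚ.*-monoʳ-≤-nonNeg r {{nonNegative (ℚ.<⇒≤ 0<r)}}

square-cancel-< : ∀ {p q} → 0ℚ ℚ.< q → p ℚ.* p ℚ.< q ℚ.* q → p ℚ.< q
square-cancel-< {p} {q} 0<q pp<qq with p ℚ.<? q
... | yes p<q = p<q
... | no  p≮q = contradiction refl (λ e → ℚ.<-irrefl e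
    (ℚ.<-≤-trans pp<qq (ℚ.≤-trans (*-monoˡ-≤′ q 0<q q≤p)
        (ℚ.*-monoˡ-≤-nonNeg p {{nonNegative (ℚ.≤-trans (ℚ.<⇒≤ 0<q) q≤p)}} q≤p))))
  where q≤p = ℚ.≮⇒≥ p≮q

ratio-^ : ∀ c ℓ .{{_ : NonZero ℓ}} m → (ι c ℚ.* (+ 1 ℚ./ ℓ)) ^ℚ m ℚ.* ι (ℓ ℕ.^ m) ≡ ι (c ℕ.^ m)
ratio-^ c ℓ@(suc ℓ′) zero    = refl
ratio-^ c ℓ@(suc ℓ′) (suc m) = begin
  x ℚ.* x ^ℚ m ℚ.* ι (ℓ ℕ.* ℓ ℕ.^ m)        ≡⟨ cong (x ℚ.* x ^ℚ m ℚ.*_) (ι-* ℓ (ℓ ℕ.^ m)) ⟩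
  x ℚ.* x ^ℚ m ℚ.* (ι ℓ ℚ.* ι (ℓ ℕ.^ m))    ≡⟨ interchange x (x ^ℚ m) (ι ℓ) _ ⟩
  x ℚ.* ι ℓ ℚ.* (x ^ℚ m ℚ.* ι (ℓ ℕ.^ m))    ≡⟨ cong₂ ℚ._*_ base (ratio-^ c ℓ m) ⟩
  ι c ℚ.* ι (c ℕ.^ m)                       ≡⟨ ι-* c (c ℕ.^ m) ⟨
  ι (c ℕ.* c ℕ.^ m)                         ∎
  where
  open ≡-Reasoning
  open CommutativeSemigroup (CommutativeMonoid.commutativeSemigroup ℚ.*-1-commutativeMonoid) using (interchange)
  x = ι c ℚ.* (+ 1 ℚ./ ℓ)
  inverse : (+ 1 ℚ./ ℓ) ℚ.* ι ℓ ≡ 1ℚ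
  inverse = trans (fromℚᵘ-homo-* (mkℚᵘ (+ 1) ℓ′) (mkℚᵘ (+ ℓ) 0))
      (ℚ.fromℚᵘ-cong {mkℚᵘ (+ 1) ℓ′ ℚᵘ.* mkℚᵘ (+ ℓ) 0} {mkℚᵘ (+ 1) 0}
    (*≡* (cong +_ (eq ℓ′))))
    where
    eq : ∀ m → (suc m ℕ.+ 0) ℕ.* 1 ≡ suc (m ℕ.* 1 ℕ.+ 0 ℕ.* suc (m ℕ.* 1))
    eq = solve-∀
  base : x ℚ.* ι ℓ ≡ ι c
  base = trans (ℚ.*-assoc (ι c) _ (ι ℓ)) (trans (cong (ι c ℚ.*_) inverse) (ℚ.*-identityʳ (ι c)))

pos-*-cancel-≤ : ∀ a b c d → + a ℤ.* + b ℤ.≤ + c ℤ.* + d → a ℕ.* b ℕ.≤ c ℕ.* d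
pos-*-cancel-≤ a b c d le = ℤ.drop‿+≤+ (subst₂ ℤ._≤_ (sym (ℤ.pos-* a b)) (sym (ℤ.pos-* c d)) le)

½≤⇒ : ∀ i j .{{_ : NonZero j}} → ½ ℚ.≤ + i ℚ./ j → j ℕ.≤ 2 ℕ.* i
½≤⇒ i j@(suc _) h with *≤* le ← fromℚᵘ-cancel-≤ {mkℚᵘ (+ 1) 1} {mkℚᵘ (+ i) _} h =
  subst₂ ℕ._≤_ (ℕ.*-identityˡ j) (ℕ.*-comm i 2) (pos-*-cancel-≤ 1 j i 2 le)

≤2⇒ : ∀ i j .{{_ : NonZero j}} → + i ℚ./ j ℚ.≤ + 2 ℚ./ 1 → i ℕ.≤ 2 ℕ.* j
≤2⇒ i j@(suc _) h with *≤* le ← fromℚᵘ-cancel-≤ {mkℚᵘ (+ i) _} {mkℚᵘ (+ 2) 0} h =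
  subst (ℕ._≤ 2 ℕ.* j) (ℕ.*-identityʳ i) (pos-*-cancel-≤ i 1 2 j le)

-- A rational q in the cut of the right side is at least a product Q of rationals a, b, t, v, one
-- from the cut of each factor. Squaring Q removes the half powers: its square exceeds `L`, the
-- square of the right side, and `L` is at least c².
real-bound : ∀ i j ℓ .{{_ : NonZero i}} .{{_ : NonZero j}} .{{_ : NonZero ℓ}} → i ℕ.≤ 2 ℕ.* j →
    j ℕ.≤ 2 ℕ.* i →
  fromℕ (C i j (+ ℓ))
    ≤ᴿ fromℕ (i ℕ.^ j) · fromℕ (j ℕ.^ i)
       · ((+ (i ℕ.+ j) ℚ./ 1) ^ (3 ℕ.* ℓ ℕ.∸ 1) /2)
       · ((ι constant ℚ.* (+ 1 ℚ./ ℓ)) ^ ℓ /2)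
real-bound i@(suc i′) j@(suc j′) ℓ@(suc ℓ′) i≤2j j≤2i {q}
  (u , v , (s , t , (a , b , α<a , β<b , ab≤s) , (0<t , N<tt) , st≤u) , (0<v , Y<vv) , uv≤q) =
  ℚ.<-≤-trans (square-cancel-< 0<Q (ℚ.≤-<-trans cc≤L L<QQ)) Q≤q
  where
  n = i ℕ.+ j
  e = 3 ℕ.* ℓ ℕ.∸ 1
  c = C i j (+ ℓ)
  α = i ℕ.^ j
  β = j ℕ.^ i
  Y = (ι constant ℚ.* (+ 1 ℚ./ ℓ)) ^ℚ ℓ
  Q = a ℚ.* b ℚ.* t ℚ.* v
  M = α ℕ.* α ℕ.* (β ℕ.* β) ℕ.* n ℕ.^ e
  L = ι α ℚ.* ι α ℚ.* (ι β ℚ.* ι β) ℚ.* ι n ^ℚ e ℚ.* Y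

  open CommutativeSemigroup (CommutativeMonoid.commutativeSemigroup ℚ.*-1-commutativeMonoid) using (interchange)

  0<α : 0ℚ ℚ.< ι α
  0<α = ι-pos α {{ℕ.m^n≢0 i j}}
  0<β : 0ℚ ℚ.< ι β
  0<β = ι-pos β {{ℕ.m^n≢0 j i}}
  0<N : 0ℚ ℚ.< ι n ^ℚ e
  0<N = ^ℚ-pos e (ι-pos n)
  0<Y : 0ℚ ℚ.< Y
  0<Y = ^ℚ-pos ℓ (*-pos (ι-pos constant) (ℚ.positive⁻¹ (+ 1 ℚ./ ℓ) {{ℚ.normalize-pos 1 ℓ}}))
  0<a = ℚ.<-trans 0<α α<a
  0<b = ℚ.<-trans 0<β β<b
  0<Q : 0ℚ ℚ.< Q
  0<Q = *-pos (*-pos (*-pos 0<a 0<b) 0<t) 0<v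

  Q≤q : Q ℚ.≤ q
  Q≤q = ℚ.≤-trans (*-monoˡ-≤′ v 0<v (ℚ.≤-trans (*-monoˡ-≤′ t 0<t ab≤s) st≤u)) uv≤q

  QQ≡ : Q ℚ.* Q ≡ a ℚ.* a ℚ.* (b ℚ.* b) ℚ.* (t ℚ.* t) ℚ.* (v ℚ.* v)
  QQ≡ = trans (interchange (a ℚ.* b ℚ.* t) v (a ℚ.* b ℚ.* t) v) (cong (ℚ._* (v ℚ.* v))
    (trans (interchange (a ℚ.* b) t (a ℚ.* b) t) (cong (ℚ._* (t ℚ.* t)) (interchange a b a b))))

  L<QQ : L ℚ.< Q ℚ.* Q
  L<QQ = subst (L ℚ.<_) (sym QQ≡) (*-mono-<′ (*-pos (*-pos (*-pos 0<α 0<α) (*-pos 0<β 0<β)) 0<N) 0<Y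
    (*-mono-<′ (*-pos (*-pos 0<α 0<α) (*-pos 0<β 0<β)) 0<N
      (*-mono-<′ (*-pos 0<α 0<α) (*-pos 0<β 0<β) (*-mono-<′ 0<α 0<α α<a α<a)
          (*-mono-<′ 0<β 0<β β<b β<b)) N<tt) Y<vv)

  ιM : ι M ≡ ι α ℚ.* ι α ℚ.* (ι β ℚ.* ι β) ℚ.* ι n ^ℚ e
  ιM = trans (ι-* (α ℕ.* α ℕ.* (β ℕ.* β)) (n ℕ.^ e)) (cong₂ ℚ._*_
    (trans (ι-* (α ℕ.* α) (β ℕ.* β)) (cong₂ ℚ._*_ (ι-* α α) (ι-* β β))) (ι-^ n e))

  L-scaled : ι (M ℕ.* constant ℕ.^ ℓ) ≡ L ℚ.* ι (ℓ ℕ.^ ℓ)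
  L-scaled = trans (ι-* M (constant ℕ.^ ℓ)) (trans (cong₂ ℚ._*_ ιM (sym (ratio-^ constant ℓ ℓ)))
    (sym (ℚ.*-assoc (ι α ℚ.* ι α ℚ.* (ι β ℚ.* ι β) ℚ.* ι n ^ℚ e) Y (ι (ℓ ℕ.^ ℓ)))))

  integral : c ℕ.* c ℕ.* ℓ ℕ.^ ℓ ℕ.≤ M ℕ.* constant ℕ.^ ℓ
  integral = ℕ.≤-trans (C-square-bound i j ℓ i≤2j j≤2i)
      (ℕ.≤-reflexive (eq (constant ℕ.^ ℓ) (n ℕ.^ e) α β))
    where
    eq : ∀ k N a b → k ℕ.* (N ℕ.* (b ℕ.* a ℕ.* (b ℕ.* a))) ≡ a ℕ.* a ℕ.* (b ℕ.* b) ℕ.* N ℕ.* k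
    eq = solve-∀

  cc≤L : ι c ℚ.* ι c ℚ.≤ L
  cc≤L = ℚ.*-cancelʳ-≤-pos (ι (ℓ ℕ.^ ℓ)) {{positive (ι-pos (ℓ ℕ.^ ℓ) {{ℕ.m^n≢0 ℓ ℓ}})}}
    (subst₂ ℚ._≤_ (trans (ι-* (c ℕ.* c) (ℓ ℕ.^ ℓ)) (cong (ℚ._* ι (ℓ ℕ.^ ℓ)) (ι-* c c))) L-scaled
        (ι-mono-≤ integral))

theorem3p5 :
    ∃[ c ] 0ℚ ℚ.< c ×
      (∀ (i j ℓ : ℕ) .{{_ : NonZero i}} .{{_ : NonZero j}} .{{_ : NonZero ℓ}} →
       + ℓ ℤ.≤ + i ℤ.* + j ℤ.- + i ℤ.- + j →
       ½ ℚ.≤ + i ℚ./ j →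
       + i ℚ./ j ℚ.≤ + 2 ℚ./ 1 →
       fromℕ (C i j (+ ℓ))
         ≤ᴿ fromℕ (i ℕ.^ j) · fromℕ (j ℕ.^ i)
            · ((+ (i ℕ.+ j) ℚ./ 1) ^ (3 ℕ.* ℓ ℕ.∸ 1) /2)
            · ((c ℚ.* (+ 1 ℚ./ ℓ)) ^ ℓ /2))
theorem3p5 = ι constant , ι-pos constant ,
  λ i j ℓ _ ½≤i/j i/j≤2 → real-bound i j ℓ (≤2⇒ i j i/j≤2) (½≤⇒ i j ½≤i/j)
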